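{- Let $q\geq 1$ and $0\leq r<s$ be fixed integers, let $x$ be a variable (or a complex number), and for $k\ge 0$ set $$e_k^{\pm}:=E_k\!\left(\tfrac{x+r}{q}\right)\pm E_k\!\left(\tfrac{x+s}{q}\right).$$ Then for all integers $m\geq 0$ we have $H_{2m}(e_k^{ - })=0$ and $$H_{2m+1}(e_k^{ - })=(-1)^{m+1}\left(\frac{s-r}{q}\right)^{2m+2}\prod_{\ell=1}^m\left(\frac{\ell^2}{4}\left(\left(\frac{s-r}{q}\right)^2-(2\ell)^2\right)\right)^{2(m+1-\ell)}.$$ Furthermore, $$H_{2m}(e_k^{+})=(-1)^{m}\frac{2^{2m+1}}{m!^2}\prod_{\ell=1}^m\left(\frac{\ell^2}{4}\left(\left(\frac{s-r}{q}\right)^2-(2\ell-1)^2\right)\right)^{2(m+1-\ell)}$$ and $$H_{2m+1}(e_k^{+})=\prod_{\ell=0}^m\frac{\ell!^4}{16^\ell}\left(\left(\frac{s-r}{q}\right)^2-(2\ell+1)^2\right)^{2(m-\ell)+1}.$$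
   Context: The Euler polynomials $E_k(x)$ are defined by $\frac{2e^{xt}}{e^t+1}=\sum_{k\ge 0}E_k(x)\frac{t^k}{k!}$. For a sequence $(c_0,c_1,\ldots)$ (indexed from $k=0$), $H_n(c_k)=\det\big(c_{i+j}\big)_{0\le i,j\le n}$. Here $m!^2=(m!)^2$, $\ell!^4=(\ell!)^4$, and empty products equal $1$. -}

module Defs where

open import Algebra.Bundles using (CommutativeRing)
open import Algebra.Morphism.Structures using (IsRingHomomorphism)
open import Data.Fin.Base using (Fin; zero; suc; toℕ; punchIn)
open import Data.Integer.Base using (+_)
open import Data.Nat.Base as ℕ using (ℕ; zero; suc; _∸_; _!; NonZero)
open import Data.Nat.Properties using (_!≢0)
open import Data.Rational.Base as ℚ using (ℚ; _/_; ½)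
import Data.Rational.Properties as ℚ
import Data.Rational.Unnormalised.Base as ℚᵘ
import Data.Rational.Unnormalised.Properties as ℚᵘ
open import Level using (_⊔_) renaming (suc to lsuc)
open import Relation.Binary.PropositionalEquality as ≡ using (_≡_)
import Algebra.Definitions.RawSemiring as RawSemiringDefs
import Algebra.Properties.AbelianGroup as AbelianGroupProperties
import Algebra.Properties.Semiring.Exp as SemiringExp
import Algebra.Properties.Semiring.Sum as SemiringSum
import Relation.Binary.Reasoning.Setoid as SetoidReasoning

-- The product of f ℓ over a ≤ ℓ ≤ b; it is 1 when b < a.
∏ : ℕ → ℕ → (ℕ → ℚ) → ℚ
∏ a b f = product {suc b ∸ a} (λ i → f (a ℕ.+ toℕ i))
  where open RawSemiringDefs ℚ.+-*-rawSemiring using (product)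

infix 5 ∏
syntax ∏ a b (λ ℓ → t) = ∏[ ℓ from a to b ] t

-- A commutative ℚ-algebra, given by its structure map ι.  Instances include
-- ℚ[X] and any ring containing ℚ, such as ℂ.
record ℚAlgebra c ℓ : Set (lsuc (c ⊔ ℓ)) where
  field
    commutativeRing : CommutativeRing c ℓ

  open CommutativeRing commutativeRing public hiding (zero)

  field
    ι                    : ℚ → Carrier
    ι-isRingHomomorphism : IsRingHomomorphism ℚ.+-*-rawRing rawRing ι

module Determinant {c ℓ} (R : CommutativeRing c ℓ) where
  open CommutativeRing R hiding (zero)
  open SemiringSum semiring using (sum)
  open SemiringExp semiring using (_^_)

  -- Laplace expansion along the first row.
  det : ∀ {n} → (Fin n → Fin n → Carrier) → Carrier
  det {zero}  M = 1#
  det {suc n} M =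
    sum λ j → (- 1#) ^ toℕ j * M zero j * det (λ i k → M (suc i) (punchIn j k))

  -- The order is n + 1: both indices run over 0, …, n.
  H : ℕ → (ℕ → Carrier) → Carrier
  H n a = det {suc n} (λ i j → a (toℕ i ℕ.+ toℕ j))

-- Formal power series, as their coefficient sequences.
module PowerSeries {c ℓ} (R : CommutativeRing c ℓ) where
  open CommutativeRing R hiding (zero)
  open SemiringSum semiring using (sum)

  Series : Set c
  Series = ℕ → Carrier

  infix  4 _≋_
  infixl 6 _⊕_
  infixl 7 _⊛_

  _≋_ : Series → Series → Set ℓ
  f ≋ g = ∀ n → f n ≈ g n

  _⊕_ : Series → Series → Series
  (f ⊕ g) n = f n + g n

  _⊛_ : Series → Series → Series
  (f ⊛ g) n = sum {suc n} (λ i → f (toℕ i) * g (n ∸ toℕ i))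

  constant : Carrier → Series
  constant a zero    = a
  constant a (suc _) = 0#

  -- Long division of f by g, where v is the inverse of the constant term of g.
  quotient : Carrier → Series → Series → Series
  quotient v f g zero    = v * f 0
  quotient v f g (suc n) =
    quotient v (λ k → f (suc k) - v * f 0 * g (suc k)) g n

  quotient-⊛ : ∀ {v} f g → v * g 0 ≈ 1# → quotient v f g ⊛ g ≋ f
  quotient-⊛ {v} f g vg₀≈1 zero = begin
    v * f 0 * g 0 + 0#  ≈⟨ +-identityʳ _ ⟩
    v * f 0 * g 0       ≈⟨ *-congʳ (*-comm v (f 0)) ⟩
    f 0 * v * g 0       ≈⟨ *-assoc _ _ _ ⟩
    f 0 * (v * g 0)     ≈⟨ *-congˡ vg₀≈1 ⟩
    f 0 * 1#            ≈⟨ *-identityʳ _ ⟩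
    f 0                 ∎
    where open SetoidReasoning setoid
  quotient-⊛ {v} f g vg₀≈1 (suc n) = begin
    h + (quotient v f′ g ⊛ g) n  ≈⟨ +-congˡ (quotient-⊛ f′ g vg₀≈1 n) ⟩
    h + (f (suc n) - h)          ≈⟨ +-assoc _ _ _ ⟨
    h + f (suc n) - h            ≈⟨ xyx⁻¹≈y h (f (suc n)) ⟩
    f (suc n)                    ∎
    where
    open SetoidReasoning setoid
    open AbelianGroupProperties +-abelianGroup using (xyx⁻¹≈y)
    h  = v * f 0 * g (suc n)
    f′ = λ k → f (suc k) - v * f 0 * g (suc k)

module Euler {c ℓ} (A : ℚAlgebra c ℓ) where
  open ℚAlgebra A hiding (Carrier; _≈_; 0#; ι)
  open ℚAlgebra A public using (Carrier; _≈_; 0#; ι)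
  open PowerSeries commutativeRing
  open Determinant commutativeRing public using (det; H)
  open SemiringExp semiring using (_^_)
  private module ι = IsRingHomomorphism ι-isRingHomomorphism

  1/_! : ℕ → ℚ
  1/ k ! = (+ 1 / k !) {{k !≢0}}

  -- e^{yt}
  exp : Carrier → Series
  exp y k = ι (1/ k !) * y ^ k

  -- 2e^{yt} and e^t + 1; the latter has constant term 2.
  numerator : Carrier → Series
  numerator y k = ι (+ 2 / 1) * exp y k

  denominator : Series
  denominator = exp 1# ⊕ constant 1#

  -- The value E_k(y) of the k-th Euler polynomial at y, read off from
  -- Σ E_k(y) t^k/k! = 2e^{yt}/(e^t + 1).
  E : ℕ → Carrier → Carrier
  E k y = ι (+ (k !) / 1) * quotient (ι ½) (numerator y) denominator k

  private
    1/n*n≡1 : ∀ n .{{_ : NonZero n}} → + 1 / n ℚ.* (+ n / 1) ≡ ℚ.1ℚ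
    1/n*n≡1 (suc n) = ℚ.toℚᵘ-injective (begin
      ℚ.toℚᵘ (+ 1 / suc n ℚ.* (+ suc n / 1))
        ≈⟨ ℚ.toℚᵘ-homo-* (+ 1 / suc n) (+ suc n / 1) ⟩
      ℚ.toℚᵘ (+ 1 / suc n) ℚᵘ.* ℚ.toℚᵘ (+ suc n / 1)
        ≈⟨ ℚᵘ.*-cong (ℚ.toℚᵘ-fromℚᵘ (ℚᵘ.mkℚᵘ (+ 1) n))
                     (ℚ.toℚᵘ-fromℚᵘ (ℚᵘ.mkℚᵘ (+ suc n) 0)) ⟩
      ℚᵘ.mkℚᵘ (+ 1) n ℚᵘ.* ℚᵘ.mkℚᵘ (+ suc n) 0
        ≈⟨ ℚᵘ.*-inverseˡ (ℚᵘ.mkℚᵘ (+ suc n) 0) ⟩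
      ℚᵘ.1ℚᵘ ∎)
      where open SetoidReasoning ℚᵘ.≃-setoid

    egf-E : ∀ y k →
      ι (1/ k !) * E k y ≈ quotient (ι ½) (numerator y) denominator k
    egf-E y k = begin
      ι (1/ k !) * (ι (+ (k !) / 1) * a)  ≈⟨ *-assoc _ _ _ ⟨
      ι (1/ k !) * ι (+ (k !) / 1) * a    ≈⟨ *-congʳ (ι.*-homo _ _) ⟨
      ι (1/ k ! ℚ.* (+ (k !) / 1)) * a
        ≈⟨ *-congʳ (ι.⟦⟧-cong (1/n*n≡1 (k !) {{k !≢0}})) ⟩
      ι ℚ.1ℚ * a                          ≈⟨ *-congʳ ι.1#-homo ⟩
      1# * a                              ≈⟨ *-identityˡ a ⟩
      a                                   ∎
      where
      open SetoidReasoning setoid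
      a = quotient (ι ½) (numerator y) denominator k

    ½*denominator₀≈1 : ι ½ * denominator 0 ≈ 1#
    ½*denominator₀≈1 = begin
      ι ½ * (ι ℚ.1ℚ * 1# + 1#)    ≈⟨ *-congˡ (+-congʳ (*-identityʳ _)) ⟩
      ι ½ * (ι ℚ.1ℚ + 1#)         ≈⟨ *-congˡ (+-congˡ ι.1#-homo) ⟨
      ι ½ * (ι ℚ.1ℚ + ι ℚ.1ℚ)     ≈⟨ *-congˡ (ι.+-homo _ _) ⟨
      ι ½ * ι (ℚ.1ℚ ℚ.+ ℚ.1ℚ)     ≈⟨ ι.*-homo _ _ ⟨
      ι ℚ.1ℚ                      ≈⟨ ι.1#-homo ⟩
      1#                          ∎
      where open SetoidReasoning setoid

  E-generatingFunction : ∀ y →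
    (λ k → ι (1/ k !) * E k y) ⊛ denominator ≋ numerator y
  E-generatingFunction y n = trans
    (sum-cong-≋ {suc n} (λ i → *-congʳ {denominator (n ∸ toℕ i)} (egf-E y (toℕ i))))
    (quotient-⊛ (numerator y) denominator ½*denominator₀≈1 n)
    where open SemiringSum semiring using (sum-cong-≋)

  module _ (q : ℕ) .{{_ : NonZero q}} (r s : ℕ) (x : Carrier) where

    -- (x + a)/q
    arg : ℕ → Carrier
    arg a = ι (+ 1 / q) * (x + ι (+ a / 1))

    e⁻ e⁺ : ℕ → Carrier
    e⁻ k = E k (arg r) - E k (arg s)
    e⁺ k = E k (arg r) + E k (arg s)

{-# OPTIONS --safe #-}
module Submission where

-- Read a sequence μ as the linear functional L on polynomials with L(X^k) = μ k.  The functional of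
-- E_k(y) satisfies L(f(X + 1) + f(X)) = 2 f(y), and central factorials f make f(X + 1) + f(X) a
-- product again.  Hence, with z the mean of (x + r)/q and (x + s)/q minus 1/2, the functionals of
-- e⁺ and e⁻ take product values on ∏ ((X - z)² - (i + α)²) for α = 0, 1 and α = 1/2 respectively
-- (times 1, (X - z)² and X - z), and vanish on the polynomials in X - z of the other parity.
-- These values are the moments of continuous dual Hahn polynomials P_k in (X - z)², for which the
-- product structure propagates through the three-term recurrence and yields orthogonality.
-- Column operations turn the Hankel matrix into the matrix of the values L(X^i p_j) with
-- p_{2k} = P_k and p_{2k+1} = (X - z) P_k, where for e⁺ the former P_k has α = 0 and the latter
-- α = 1: this is triangular for e⁺, and has antidiagonal 2 × 2 blocks on its diagonal for e⁻.

open import Defs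
open import Algebra.Morphism.Structures using (IsRingHomomorphism)
import Algebra.Properties.Ring as RingProperties
import Algebra.Properties.Semiring.Exp as SemiringExp
import Algebra.Properties.Semiring.Sum as SemiringSum
import Algebra.Solver.Ring as RingSolver
open import Algebra.Solver.Ring.AlmostCommutativeRing using (fromCommutativeRing; _-Raw-AlmostCommutative⟶_)
open import Data.Fin.Base using (Fin; zero; suc; toℕ; punchIn)
open import Data.Fin.Properties using (toℕ≤pred[n])
open import Data.Integer.Base as ℤ using (+_)
import Data.Integer.Properties as ℤ
open import Data.List.Base using (List; []; _∷_; _++_; [_]; map; tabulate; applyUpTo)
open import Data.List.Properties using (map-tabulate; map-++; map-applyUpTo; applyUpTo-∷ʳ; ∷ʳ-++; ++-identityʳ)
open import Data.List.Relation.Binary.Pointwise as PW using (Pointwise; []; _∷_)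
open import Data.List.Relation.Unary.All using (All; []; _∷_)
open import Data.List.Relation.Unary.All.Properties using (applyUpTo⁺₂)
open import Data.Maybe.Base using (Maybe; just; nothing)
open import Data.Nat.Base as ℕ using (ℕ; zero; suc; _!; _∸_; _<_; NonZero; z≤n; s≤s; z<s; s<s)
import Data.Nat.Properties as ℕ
open import Data.Nat.Properties using (m^n≢0; _!≢0)
open import Data.Product.Base using (_×_; _,_; Σ; proj₁; proj₂)
open import Data.Rational.Base as ℚ using (ℚ; ½; 0ℚ; 1ℚ; _/_)
import Data.Rational.Properties as ℚ
import Data.Rational.Solver as ℚ
import Data.Rational.Unnormalised.Base as ℚᵘ
import Data.Rational.Unnormalised.Properties as ℚᵘ
open import Function.Base using (_∘_; id)
import Level
import Relation.Binary.PropositionalEquality as ≡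
open ≡ using (_≡_)
import Relation.Binary.Reasoning.Setoid as SetoidReasoning
open import Relation.Nullary using (yes; no)

-- For a product f of r + 1 consecutive factors X - a, ..., X - a - r, the polynomials f(X + 1) and
-- f(X) share r factors, and the two remaining ones add up to 2 (X - z), with z the midpoint of the
-- shared roots. The roots of f itself are symmetric about z + 1/2, which is where the 1/2
-- subtracted from the mean comes from. With u the difference of the two arguments, these lie at
-- distance u/2 on either side of z + 1/2, so f(y) changes at most its sign between them: for each
-- parity of the number of factors, either the sum or the difference cancels. The variable x enters
-- only through z, so all values on central factorials are rational.
--
-- The recurrence coefficients are therefore written down in advance and verified on the central
-- factorials, which involves no division by norms and works over any commutative algebra over the
-- rationals.

module AlgebraSolver {c ℓ} (A : ℚAlgebra c ℓ) where
  open ℚAlgebra A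
  module ι = IsRingHomomorphism ι-isRingHomomorphism

  private
    -- Agrees with ι, but sends 0 and 1 to 0# and 1# definitionally.
    embed : ℚ → Carrier
    embed q with q ℚ.≟ ℚ.0ℚ | q ℚ.≟ ℚ.1ℚ
    ... | yes _ | _     = 0#
    ... | no _  | yes _ = 1#
    ... | no _  | no _  = ι q

    embed≈ι : ∀ q → embed q ≈ ι q
    embed≈ι q with q ℚ.≟ ℚ.0ℚ | q ℚ.≟ ℚ.1ℚ
    ... | yes q≡0 | _       = sym (trans (ι.⟦⟧-cong q≡0) ι.0#-homo)
    ... | no _    | yes q≡1 = sym (trans (ι.⟦⟧-cong q≡1) ι.1#-homo)
    ... | no _    | no _    = refl

    embed-morphism : ℚ.+-*-rawRing -Raw-AlmostCommutative⟶ fromCommutativeRing commutativeRing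
    embed-morphism = record
      { ⟦_⟧    = embed
      ; +-homo = λ p q → trans (embed≈ι _) (trans (ι.+-homo p q) (sym (+-cong (embed≈ι p) (embed≈ι q))))
      ; *-homo = λ p q → trans (embed≈ι _) (trans (ι.*-homo p q) (sym (*-cong (embed≈ι p) (embed≈ι q))))
      ; -‿homo = λ q → trans (embed≈ι _) (trans (ι.-‿homo q) (sym (-‿cong (embed≈ι q))))
      ; 0-homo = refl
      ; 1-homo = refl
      }

    _≈?_ : ∀ p q → Maybe (embed p ≈ embed q)
    p ≈? q with p ℚ.≟ q
    ... | yes p≡q = just (reflexive (≡.cong embed p≡q))
    ... | no _    = nothing

  open RingSolver ℚ.+-*-rawRing (fromCommutativeRing commutativeRing) embed-morphism _≈?_ public
    using (Polynomial; solve; con; _:=_; _:+_; _:*_; _:-_; :-_)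

  :0 :1 :½ : ∀ {n} → Polynomial n
  :0 = con ℚ.0ℚ
  :1 = con ℚ.1ℚ
  :½ = con ℚ.½

-- The two branches trade places at each successor. Even numbers are written `k ℕ.* 2` because
-- `suc k ℕ.* 2` reduces to two successors.
parity : ∀ {p} (P : ℕ → Set p) → (∀ k → P (k ℕ.* 2)) → (∀ k → P (suc (k ℕ.* 2))) → ∀ n → P n
parity P even odd zero    = even 0
parity P even odd (suc n) = parity (λ m → P (suc m)) odd (even ∘ suc) n

parity-even : ∀ {p} (P : ℕ → Set p) even odd k → parity P even odd (k ℕ.* 2) ≡ even k
parity-even P even odd zero    = ≡.refl
parity-even P even odd (suc k) = parity-even (λ m → P (suc (suc m))) (λ k → even (suc k)) (λ k → odd (suc k)) k

parity-odd : ∀ {p} (P : ℕ → Set p) even odd k → parity P even odd (suc (k ℕ.* 2)) ≡ odd k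
parity-odd P even odd k = parity-even (λ m → P (suc m)) odd (λ k → even (suc k)) k

-- Splits off the last factor, whereas `∏` splits off the first: the closed forms are proved by
-- appending factors at the end.
∏< : (ℕ → ℚ) → ℕ → ℚ
∏< h zero    = ℚ.1ℚ
∏< h (suc n) = ∏< h n ℚ.* h n

∏<-first : ∀ h n → ∏< h (suc n) ≡ h 0 ℚ.* ∏< (h ∘ suc) n
∏<-first h zero    = ℚ.*-comm ℚ.1ℚ (h 0)
∏<-first h (suc n) = ≡.trans (≡.cong (ℚ._* h (suc n)) (∏<-first h n)) (ℚ.*-assoc (h 0) _ _)

module SequenceModule {c ℓ} (A : ℚAlgebra c ℓ) where
  open ℚAlgebra A
  open PowerSeries commutativeRing using (Series; _≋_; _⊕_) public

  infixr 7 _⊙_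
  _⊙_ : Carrier → Series → Series
  (k ⊙ f) n = k * f n

  𝟘 : Series
  𝟘 _ = 0#

  shift : Series → Series
  shift f n = f (suc n)

-- Determinants as alternating functions of their columns

module ColumnExpansion {c ℓ} (A : ℚAlgebra c ℓ) where
  open ℚAlgebra A
  open AlgebraSolver A
  open SequenceModule A
  open Determinant commutativeRing using (det; H)
  open RingProperties ring using (-‿distribˡ-*)
  open SemiringExp semiring using (_^_)
  open SemiringSum semiring using (sum; sum-cong-≋; *-distribˡ-sum)

  -- Laplace expansion along the first row; φ evaluates the minors.
  expand : (List Series → Carrier) → List Series → Carrier
  expand φ []       = 0#
  expand φ (v ∷ vs) = v 0 * φ (map shift vs) - expand (λ ws → φ (shift v ∷ ws)) vs

  -- The determinant of the first n rows of the matrix with the n given columns.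
  D : ℕ → List Series → Carrier
  D zero    []      = 1#
  D zero    (_ ∷ _) = 0#
  D (suc n)         = expand (D n)

  private
    -- The signs of the Laplace sum become nested subtractions: past the first column a common
    -- factor -1 comes out of the sum, and that column, shifted, joins every remaining minor.
    expand-tabulate : ∀ φ {n} (v : Fin (suc n) → Series) →
      sum (λ j → (- 1#) ^ toℕ j * v j 0 * φ (tabulate (λ k → shift (v (punchIn j k)))))
        ≈ expand φ (tabulate v)
    expand-tabulate φ {zero} v =
      solve 2 (λ a b → :1 :* a :* b :+ :0 := a :* b :- :0) refl (v zero 0) (φ [])
    expand-tabulate φ {suc n} v = begin
      1# * v zero 0 * φ (tabulate (λ k → shift (v (suc k))))
        + sum (λ j → - 1# * (- 1#) ^ toℕ j * v (suc j) 0 * ψ j)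
        ≈⟨ +-cong (*-cong (*-identityˡ _) (reflexive (≡.cong φ (≡.sym (map-tabulate (v ∘ suc) shift)))))
             (sum-cong-≋ {suc n} λ j → solve 4 (λ m a b c → m :* a :* b :* c := m :* (a :* b :* c)) refl
                (- 1#) ((- 1#) ^ toℕ j) (v (suc j) 0) (ψ j)) ⟩
      v zero 0 * φ (map shift (tabulate (v ∘ suc)))
        + sum (λ j → - 1# * ((- 1#) ^ toℕ j * v (suc j) 0 * ψ j))
        ≈⟨ +-congˡ (*-distribˡ-sum {suc n} (- 1#) (λ j → (- 1#) ^ toℕ j * v (suc j) 0 * ψ j)) ⟨
      v zero 0 * φ (map shift (tabulate (v ∘ suc)))
        + - 1# * sum (λ j → (- 1#) ^ toℕ j * v (suc j) 0 * ψ j)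
        ≈⟨ +-congˡ (trans (sym (-‿distribˡ-* 1# _)) (-‿cong (trans (*-identityˡ _)
             (expand-tabulate (λ ws → φ (shift (v zero) ∷ ws)) (v ∘ suc))))) ⟩
      expand φ (tabulate v) ∎
      where
      open SetoidReasoning setoid
      ψ = λ j → φ (tabulate (λ k → shift (v (punchIn (suc j) k))))

  det-columns : ∀ {n} (v : Fin n → Series) → det (λ i j → v j (toℕ i)) ≈ D n (tabulate v)
  det-columns {zero}  v = refl
  det-columns {suc n} v = trans
    (sum-cong-≋ {suc n} λ j → *-congˡ {(- 1#) ^ toℕ j * v j 0} (det-columns (λ k → shift (v (punchIn j k)))))
    (expand-tabulate (D n) v)

  -- Only neighbouring equal columns are required to give 0. This suffices, since the column
  -- operations below move a column past one neighbour at a time.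
  record Alternating (φ : List Series → Carrier) : Set (c Level.⊔ ℓ) where
    field
      congruent : ∀ {us vs} → Pointwise _≋_ us vs → φ us ≈ φ vs
      linear    : ∀ us f k g vs → φ (us ++ (f ⊕ k ⊙ g) ∷ vs) ≈ φ (us ++ f ∷ vs) + k * φ (us ++ g ∷ vs)
      equal     : ∀ us f vs → φ (us ++ f ∷ f ∷ vs) ≈ 0#

    ≋-refl : ∀ us → Pointwise _≋_ us us
    ≋-refl us = PW.refl (λ _ → refl)

    at-congruent : ∀ us {f g} vs → f ≋ g → φ (us ++ f ∷ vs) ≈ φ (us ++ g ∷ vs)
    at-congruent us vs f≋g = congruent (PW.++⁺ (≋-refl us) (f≋g ∷ ≋-refl vs))

    vanishing : ∀ us {f} vs → f ≋ 𝟘 → φ (us ++ f ∷ vs) ≈ 0#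
    vanishing us {f} vs f≋𝟘 = begin
      φ (us ++ f ∷ vs)                               ≈⟨ at-congruent us vs f≋f-f ⟩
      φ (us ++ (f ⊕ (- 1#) ⊙ f) ∷ vs)                 ≈⟨ linear us f (- 1#) f vs ⟩
      φ (us ++ f ∷ vs) + - 1# * φ (us ++ f ∷ vs)      ≈⟨ a-a≈0 (φ (us ++ f ∷ vs)) ⟩
      0#                                              ∎
      where
      open SetoidReasoning setoid
      a-a≈0 : ∀ a → a + - 1# * a ≈ 0#
      a-a≈0 = solve 1 (λ a → a :+ (:- :1) :* a := :0) refl
      f≋f-f : f ≋ f ⊕ (- 1#) ⊙ f
      f≋f-f n = trans (f≋𝟘 n) (sym (a-a≈0 (f n)))

    -- Polarisation: f + g placed in both columns gives 0.
    swap : ∀ us f g vs → φ (us ++ f ∷ g ∷ vs) ≈ - φ (us ++ g ∷ f ∷ vs)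
    swap us f g vs = begin
      φ (us ++ f ∷ g ∷ vs)                ≈⟨ trans (+-congˡ (trans (*-identityˡ _) (equal us g vs))) (+-identityʳ _) ⟨
      φ (us ++ f ∷ g ∷ vs) + 1# * φ (us ++ g ∷ g ∷ vs) ≈⟨ linear us f 1# g (g ∷ vs) ⟨
      φ (us ++ h ∷ g ∷ vs)                ≈⟨ add-sub (φ (us ++ h ∷ g ∷ vs)) (φ (us ++ h ∷ f ∷ vs)) ⟩
      (φ (us ++ h ∷ f ∷ vs) + 1# * φ (us ++ h ∷ g ∷ vs)) - φ (us ++ h ∷ f ∷ vs)
                                           ≈⟨ +-congʳ hh≈0 ⟩
      0# - φ (us ++ h ∷ f ∷ vs)            ≈⟨ +-identityˡ _ ⟩
      - φ (us ++ h ∷ f ∷ vs)               ≈⟨ -‿cong (linear us f 1# g (f ∷ vs)) ⟩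
      - (φ (us ++ f ∷ f ∷ vs) + 1# * φ (us ++ g ∷ f ∷ vs))
        ≈⟨ -‿cong (trans (+-cong (equal us f vs) (*-identityˡ _)) (+-identityˡ _)) ⟩
      - φ (us ++ g ∷ f ∷ vs)               ∎
      where
      open SetoidReasoning setoid
      h = f ⊕ 1# ⊙ g
      add-sub : ∀ a b → a ≈ (b + 1# * a) - b
      add-sub = solve 2 (λ a b → a := (b :+ :1 :* a) :- b) refl
      hh≈0 : φ (us ++ h ∷ f ∷ vs) + 1# * φ (us ++ h ∷ g ∷ vs) ≈ 0#
      hh≈0 = begin
        φ (us ++ h ∷ f ∷ vs) + 1# * φ (us ++ h ∷ g ∷ vs)
          ≡⟨ ≡.cong₂ (λ x y → φ x + 1# * φ y) (∷ʳ-++ us h (f ∷ vs)) (∷ʳ-++ us h (g ∷ vs)) ⟨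
        φ ((us ++ [ h ]) ++ f ∷ vs) + 1# * φ ((us ++ [ h ]) ++ g ∷ vs)
          ≈⟨ linear (us ++ [ h ]) f 1# g vs ⟨
        φ ((us ++ [ h ]) ++ h ∷ vs)  ≡⟨ ≡.cong φ (∷ʳ-++ us h (h ∷ vs)) ⟩
        φ (us ++ h ∷ h ∷ vs)         ≈⟨ equal us h vs ⟩
        0#                           ∎

  open Alternating

  private
    expand-cong : ∀ {φ ψ} → (∀ us → φ us ≈ ψ us) → ∀ us → expand φ us ≈ expand ψ us
    expand-cong φ≈ψ []       = refl
    expand-cong φ≈ψ (v ∷ us) =
      +-cong (*-congˡ (φ≈ψ _)) (-‿cong (expand-cong (λ ws → φ≈ψ (shift v ∷ ws)) us))

    expand-zero : ∀ {φ} → (∀ us → φ us ≈ 0#) → ∀ us → expand φ us ≈ 0#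
    expand-zero φ≈0 []       = refl
    expand-zero φ≈0 (v ∷ us) = trans
      (+-cong (trans (*-congˡ (φ≈0 _)) (zeroʳ _)) (-‿cong (expand-zero (λ ws → φ≈0 (shift v ∷ ws)) us)))
      (-‿inverseʳ 0#)

    expand-linear : ∀ {φ ψ χ} k → (∀ us → φ us ≈ ψ us + k * χ us) →
      ∀ us → expand φ us ≈ expand ψ us + k * expand χ us
    expand-linear k h []       = sym (trans (+-identityˡ _) (zeroʳ k))
    expand-linear {φ} {ψ} {χ} k h (v ∷ us) = trans
      (+-cong (*-congˡ (h _)) (-‿cong (expand-linear k (λ ws → h (shift v ∷ ws)) us)))
      (solve 6 (λ v a k b e d → v :* (a :+ k :* b) :- (e :+ k :* d) := (v :* a :- e) :+ k :* (v :* b :- d))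
         refl (v 0) (ψ (map shift us)) k (χ (map shift us)) _ _)

    tail-alternating : ∀ {φ} v → Alternating φ → Alternating (λ ws → φ (v ∷ ws))
    tail-alternating v φ-alt = record
      { congruent = λ us≋vs → congruent φ-alt ((λ _ → refl) ∷ us≋vs)
      ; linear    = λ us → linear φ-alt (v ∷ us)
      ; equal     = λ us → equal φ-alt (v ∷ us)
      }

    expand-alternating : ∀ {φ} → Alternating φ → Alternating (expand φ)
    expand-alternating φ-alt = record
      { congruent = expand-congruent φ-alt ; linear = expand-lin φ-alt ; equal = expand-equal φ-alt }
      where
      expand-congruent : ∀ {φ} → Alternating φ → ∀ {us vs} → Pointwise _≋_ us vs → expand φ us ≈ expand φ vs
      expand-congruent φ-alt [] = refl
      expand-congruent {φ} φ-alt (_∷_ {u} {v} {us} {vs} u≋v us≋vs) = +-cong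
        (*-cong (u≋v 0) (congruent φ-alt (PW.map⁺ shift shift (PW.map (λ f≋g n → f≋g (suc n)) us≋vs))))
        (-‿cong (trans (expand-cong (λ ws → congruent φ-alt ((λ n → u≋v (suc n)) ∷ ≋-refl φ-alt ws)) us)
                       (expand-congruent (tail-alternating (shift v) φ-alt) us≋vs)))

      expand-lin : ∀ {φ} → Alternating φ → ∀ us f k g vs →
        expand φ (us ++ (f ⊕ k ⊙ g) ∷ vs) ≈ expand φ (us ++ f ∷ vs) + k * expand φ (us ++ g ∷ vs)
      expand-lin {φ} φ-alt [] f k g vs = trans
        (+-congˡ (-‿cong (expand-linear k (λ ws → linear φ-alt [] (shift f) k (shift g) ws) vs)))
        (solve 6 (λ f k g p e d → (f :+ k :* g) :* p :- (e :+ k :* d) := (f :* p :- e) :+ k :* (g :* p :- d))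
           refl (f 0) k (g 0) (φ (map shift vs)) _ _)
      expand-lin {φ} φ-alt (u ∷ us) f k g vs
        rewrite map-++ shift us ((f ⊕ k ⊙ g) ∷ vs) | map-++ shift us (f ∷ vs) | map-++ shift us (g ∷ vs) = trans
        (+-cong (*-congˡ (linear φ-alt (map shift us) (shift f) k (shift g) (map shift vs)))
                (-‿cong (expand-lin (tail-alternating (shift u) φ-alt) us f k g vs)))
        (solve 6 (λ v a k b e d → v :* (a :+ k :* b) :- (e :+ k :* d) := (v :* a :- e) :+ k :* (v :* b :- d))
           refl (u 0) _ k _ _ _)

      expand-equal : ∀ {φ} → Alternating φ → ∀ us f vs → expand φ (us ++ f ∷ f ∷ vs) ≈ 0#
      -- The terms of the two equal columns cancel; every other minor still contains both copies.
      expand-equal {φ} φ-alt [] f vs = trans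
        (solve 2 (λ a e → a :- (a :- e) := e) refl
           (f 0 * φ (shift f ∷ map shift vs)) _)
        (expand-zero (λ ws → equal φ-alt [] (shift f) ws) vs)
      expand-equal {φ} φ-alt (u ∷ us) f vs rewrite map-++ shift us (f ∷ f ∷ vs) = trans
        (+-cong (trans (*-congˡ (equal φ-alt (map shift us) (shift f) (map shift vs))) (zeroʳ _))
                (-‿cong (expand-equal (tail-alternating (shift u) φ-alt) us f vs)))
        (-‿inverseʳ 0#)

  D-alternating : ∀ n → Alternating (D n)
  D-alternating (suc n) = expand-alternating (D-alternating n)
  D-alternating zero = record
    { congruent = λ { [] → refl ; (_ ∷ _) → refl }
    ; linear    = λ { [] _ k _ _ → sym (trans (+-identityˡ _) (zeroʳ k))
                    ; (_ ∷ _) _ k _ _ → sym (trans (+-identityˡ _) (zeroʳ k)) }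
    ; equal     = λ { [] _ _ → refl ; (_ ∷ _) _ _ → refl }
    }

  module _ (w : ℕ → Series) where

    -- Membership in the span of the first n columns, recorded as the column operations that reduce
    -- f to zero: k is the negative of the coordinate at `w n`.
    InSpan : ℕ → Series → Set (c Level.⊔ ℓ)
    InSpan zero    f = Level.Lift c (f ≋ 𝟘)
    InSpan (suc n) f = Σ Carrier λ k → InSpan n (f ⊕ k ⊙ w n)

    -- Once f has been swapped with `w n`, adding a multiple of `w n` to it changes nothing, and
    -- this brings f into the span of the columns still to its left.
    span-column : ∀ {φ} → Alternating φ → ∀ n {f} vs → InSpan n f → φ (applyUpTo w n ++ f ∷ vs) ≈ 0#
    span-column φ-alt zero vs (Level.lift f≋𝟘) = vanishing φ-alt [] vs f≋𝟘
    span-column {φ} φ-alt (suc n) {f} vs (k , f-in) = begin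
      φ (applyUpTo w (suc n) ++ f ∷ vs)  ≡⟨ ≡.cong (λ us → φ (us ++ f ∷ vs)) (applyUpTo-∷ʳ w n) ⟨
      φ ((us ++ [ w n ]) ++ f ∷ vs)      ≡⟨ ≡.cong φ (∷ʳ-++ us (w n) (f ∷ vs)) ⟩
      φ (us ++ w n ∷ f ∷ vs)             ≈⟨ swap φ-alt us (w n) f vs ⟩
      - φ (us ++ f ∷ w n ∷ vs)
        ≈⟨ -‿cong (trans (+-congˡ (trans (*-congˡ (equal φ-alt us (w n) vs)) (zeroʳ k))) (+-identityʳ _)) ⟨
      - (φ (us ++ f ∷ w n ∷ vs) + k * φ (us ++ w n ∷ w n ∷ vs))
        ≈⟨ -‿cong (linear φ-alt us f k (w n) (w n ∷ vs)) ⟨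
      - φ (us ++ (f ⊕ k ⊙ w n) ∷ w n ∷ vs) ≈⟨ -‿cong (span-column φ-alt n (w n ∷ vs) f-in) ⟩
      - 0#                               ≈⟨ trans (sym (+-identityˡ _)) (-‿inverseʳ 0#) ⟩
      0#                                 ∎
      where
      open SetoidReasoning setoid
      us = applyUpTo w n

    Monic : ℕ → Series → Set (c Level.⊔ ℓ)
    Monic n f = InSpan n (f ⊕ (- 1#) ⊙ w n)

    -- Columns are replaced from the last one down: column n changes while the columns before it are
    -- still the `w i`, whose span contains p n - w n.
    unitriangular : ∀ {φ} → Alternating φ → (p : ℕ → Series) → (∀ n → Monic n (p n)) →
      ∀ n vs → φ (applyUpTo w n ++ vs) ≈ φ (applyUpTo p n ++ vs)
    unitriangular φ-alt p p-monic zero    vs = refl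
    unitriangular {φ} φ-alt p p-monic (suc n) vs = begin
      φ (applyUpTo w (suc n) ++ vs)      ≡⟨ ≡.cong (λ us → φ (us ++ vs)) (applyUpTo-∷ʳ w n) ⟨
      φ ((us ++ [ w n ]) ++ vs)          ≡⟨ ≡.cong φ (∷ʳ-++ us (w n) vs) ⟩
      φ (us ++ w n ∷ vs)                 ≈⟨ a-b≈0⇒b≈a (φ (us ++ p n ∷ vs)) (φ (us ++ w n ∷ vs))
                                              (trans (sym (linear φ-alt us (p n) (- 1#) (w n) vs))
                                                     (span-column φ-alt n vs (p-monic n))) ⟩
      φ (us ++ p n ∷ vs)                 ≈⟨ unitriangular φ-alt p p-monic n (p n ∷ vs) ⟩
      φ (applyUpTo p n ++ p n ∷ vs)      ≡⟨ ≡.cong φ (∷ʳ-++ (applyUpTo p n) (p n) vs) ⟨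
      φ ((applyUpTo p n ++ [ p n ]) ++ vs) ≡⟨ ≡.cong (λ us → φ (us ++ vs)) (applyUpTo-∷ʳ p n) ⟩
      φ (applyUpTo p (suc n) ++ vs)      ∎
      where
      open SetoidReasoning setoid
      us = applyUpTo w n
      a-b≈0⇒b≈a : ∀ a b → a + - 1# * b ≈ 0# → b ≈ a
      a-b≈0⇒b≈a a b h = trans
        (solve 2 (λ a b → b := a :- (a :+ (:- :1) :* b)) refl a b)
        (trans (+-congˡ (-‿cong h)) (solve 1 (λ a → a :- :0 := a) refl a))

    span-cong : ∀ n {f g} → f ≋ g → InSpan n f → InSpan n g
    span-cong zero    f≋g (Level.lift f≋𝟘) = Level.lift λ i → trans (sym (f≋g i)) (f≋𝟘 i)
    span-cong (suc n) f≋g (k , f-in) = k , span-cong n (λ i → +-congʳ (f≋g i)) f-in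

    span-combine : ∀ n {f g} k → InSpan n f → InSpan n g → InSpan n (f ⊕ k ⊙ g)
    span-combine zero k (Level.lift f≋𝟘) (Level.lift g≋𝟘) = Level.lift λ i →
      trans (+-cong (f≋𝟘 i) (trans (*-congˡ (g≋𝟘 i)) (zeroʳ k))) (+-identityʳ 0#)
    span-combine (suc n) {f} {g} k (a , f-in) (b , g-in) = a + k * b ,
      span-cong n (λ i → solve 6 (λ f a w k g b →
          (f :+ a :* w) :+ k :* (g :+ b :* w) := (f :+ k :* g) :+ (a :+ k :* b) :* w)
          refl (f i) a (w n i) k (g i) b)
        (span-combine n k f-in g-in)

    span-suc : ∀ n {f} → InSpan n f → InSpan (suc n) f
    span-suc n {f} f-in = 0# ,
      span-cong n (λ i → sym (trans (+-congˡ (zeroˡ _)) (+-identityʳ (f i)))) f-in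

    zero-span : ∀ n {f} → f ≋ 𝟘 → InSpan n f
    zero-span zero    f≋𝟘 = Level.lift f≋𝟘
    zero-span (suc n) f≋𝟘 = span-suc n (zero-span n f≋𝟘)

    w-span : ∀ n → InSpan (suc n) (w n)
    w-span n = - 1# , zero-span n (λ i → trans (+-congʳ (sym (*-identityˡ (w n i))))
      (trans (sym (distribʳ (w n i) 1# (- 1#))) (trans (*-congʳ (-‿inverseʳ 1#)) (zeroˡ _))))

    monic-span : ∀ n {f} → Monic n f → InSpan (suc n) f
    monic-span n {f} f-monic = span-cong (suc n)
      (λ i → solve 2 (λ f w → (f :+ (:- :1) :* w) :+ :1 :* w := f) refl (f i) (w n i))
      (span-combine (suc n) 1# (span-suc n f-monic) (w-span n))

    monic-add : ∀ n {f g} k → Monic n f → InSpan n g → Monic n (f ⊕ k ⊙ g)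
    monic-add n {f} {g} k f-monic g-in = span-cong n
      (λ i → solve 4 (λ f k g w → (f :+ (:- :1) :* w) :+ k :* g := (f :+ k :* g) :+ (:- :1) :* w)
          refl (f i) k (g i) (w n i))
      (span-combine n k f-monic g-in)

    monic-cong : ∀ n {f g} → f ≋ g → Monic n f → Monic n g
    monic-cong n f≋g = span-cong n (λ i → +-congʳ (f≋g i))

    monic-zero : Monic 0 (w 0)
    monic-zero = Level.lift λ i →
      solve 1 (λ f → f :+ (:- :1) :* f := :0) refl (w 0 i)

    module _ (shift-w : ∀ n → shift (w n) ≋ w (suc n)) where

      shift-span : ∀ n {f} → InSpan n f → InSpan (suc n) (shift f)
      shift-span zero    (Level.lift f≋𝟘) = span-suc 0 (Level.lift λ i → f≋𝟘 (suc i))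
      shift-span (suc n) (k , f-in) = k ,
        span-cong (suc n) (λ i → +-congˡ (*-congˡ (shift-w n i))) (shift-span n f-in)

      monic-shift : ∀ n {f} → Monic n f → Monic (suc n) (shift f)
      monic-shift n f-monic =
        span-cong (suc n) (λ i → +-congˡ (*-congˡ (shift-w n i))) (shift-span n f-monic)

  -- Column j of the Hankel matrix, which is also μ shifted j times, that is, the functional
  -- multiplied by X^j.
  powers : Series → ℕ → Series
  powers μ j i = μ (i ℕ.+ j)

  H-monic : ∀ μ (p : ℕ → Series) → (∀ n → Monic (powers μ) n (p n)) →
    ∀ n → H n μ ≈ D (suc n) (applyUpTo p (suc n))
  H-monic μ p p-monic n = begin
    H n μ                                            ≈⟨ det-columns {suc n} (λ j i → μ (i ℕ.+ toℕ j)) ⟩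
    D (suc n) (tabulate {n = suc n} (powers μ ∘ toℕ))           ≡⟨ ≡.cong (D (suc n)) (tabulate-toℕ (powers μ) (suc n)) ⟩
    D (suc n) (applyUpTo (powers μ) (suc n))         ≡⟨ ≡.cong (D (suc n)) (++-identityʳ (applyUpTo (powers μ) (suc n))) ⟨
    D (suc n) (applyUpTo (powers μ) (suc n) ++ [])   ≈⟨ unitriangular (powers μ) (D-alternating (suc n)) p p-monic (suc n) [] ⟩
    D (suc n) (applyUpTo p (suc n) ++ [])            ≡⟨ ≡.cong (D (suc n)) (++-identityʳ (applyUpTo p (suc n))) ⟩
    D (suc n) (applyUpTo p (suc n))                  ∎
    where
    open SetoidReasoning setoid
    open import Data.List.Properties using (++-identityʳ)
    tabulate-toℕ : ∀ {a} {X : Set a} (f : ℕ → X) n → tabulate {n = n} (f ∘ toℕ) ≡ applyUpTo f n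
    tabulate-toℕ f zero    = ≡.refl
    tabulate-toℕ f (suc n) = ≡.cong (f 0 ∷_) (tabulate-toℕ (f ∘ suc) n)

  expand-skip : ∀ φ v {vs} → All (λ f → f 0 ≈ 0#) vs → expand φ (v ∷ vs) ≈ v 0 * φ (map shift vs)
  expand-skip φ v {vs} vs≈0 = trans (+-congˡ (-‿cong (expand-heads φ′ vs≈0)))
    (trans (+-congˡ (trans (sym (+-identityˡ _)) (-‿inverseʳ 0#))) (+-identityʳ _))
    where
    φ′ = λ ws → φ (shift v ∷ ws)
    expand-heads : ∀ φ {vs} → All (λ f → f 0 ≈ 0#) vs → expand φ vs ≈ 0#
    expand-heads φ []               = refl
    expand-heads φ (v₀≈0 ∷ vs≈0) = trans
      (+-cong (trans (*-congʳ v₀≈0) (zeroˡ _)) (-‿cong (expand-heads _ vs≈0)))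
      (-‿inverseʳ 0#)

  triangular : ∀ n (T : ℕ → Series) (h : ℕ → ℚ) →
    (∀ j i → i < j → T j i ≈ 0#) → (∀ j → T j j ≈ ι (h j)) →
    D n (applyUpTo T n) ≈ ι (∏< h n)
  triangular zero    T h T≈0 T≈h = sym ι.1#-homo
  triangular (suc n) T h T≈0 T≈h = begin
    expand (D n) (T 0 ∷ applyUpTo (T ∘ suc) n)
      ≈⟨ expand-skip (D n) (T 0) (applyUpTo⁺₂ (T ∘ suc) n (λ j → T≈0 (suc j) 0 z<s)) ⟩
    T 0 0 * D n (map shift (applyUpTo (T ∘ suc) n))
      ≡⟨ ≡.cong (λ vs → T 0 0 * D n vs) (map-applyUpTo (T ∘ suc) shift n) ⟩
    T 0 0 * D n (applyUpTo (shift ∘ T ∘ suc) n)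
      ≈⟨ *-cong (T≈h 0) (triangular n (shift ∘ T ∘ suc) (h ∘ suc)
           (λ j i i<j → T≈0 (suc j) (suc i) (s<s i<j)) (T≈h ∘ suc)) ⟩
    ι (h 0) * ι (∏< (h ∘ suc) n)   ≈⟨ ι.*-homo _ _ ⟨
    ι (h 0 ℚ.* ∏< (h ∘ suc) n)     ≡⟨ ≡.cong ι (∏<-first h n) ⟨
    ι (∏< h (suc n))               ∎
    where open SetoidReasoning setoid

  private
    -- Row 0 can only pick column v, after which row 1 can only pick column u, whatever v 1 is; the
    -- crossing gives the minus sign.
    expand-block : ∀ n u v (R : ℕ → Series) m a → u 0 ≈ 0# → u 1 ≈ ι a → v 0 ≈ ι a →
      (∀ j → R j 0 ≈ 0#) → (∀ j → R j 1 ≈ 0#) →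
      D (suc (suc n)) (u ∷ v ∷ applyUpTo R m)
        ≈ ι (ℚ.- (a ℚ.* a)) * D n (applyUpTo (shift ∘ shift ∘ R) m)
    expand-block n u v R m a u₀≈0 u₁≈a v₀≈a R₀≈0 R₁≈0 = begin
      u 0 * _ - expand φ (v ∷ applyUpTo R m)
        ≈⟨ +-cong (trans (*-congʳ u₀≈0) (zeroˡ _)) (-‿cong (expand-skip φ v (applyUpTo⁺₂ R m R₀≈0))) ⟩
      0# - v 0 * D (suc n) (shift u ∷ map shift (applyUpTo R m))
        ≡⟨ ≡.cong (λ vs → 0# - v 0 * D (suc n) (shift u ∷ vs)) (map-applyUpTo R shift m) ⟩
      0# - v 0 * D (suc n) (shift u ∷ applyUpTo (shift ∘ R) m)
        ≈⟨ +-congˡ (-‿cong (*-congˡ (expand-skip (D n) (shift u) (applyUpTo⁺₂ (shift ∘ R) m R₁≈0)))) ⟩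
      0# - v 0 * (u 1 * D n (map shift (applyUpTo (shift ∘ R) m)))
        ≡⟨ ≡.cong (λ vs → 0# - v 0 * (u 1 * D n vs)) (map-applyUpTo (shift ∘ R) shift m) ⟩
      0# - v 0 * (u 1 * d)      ≈⟨ +-congˡ (-‿cong (*-cong v₀≈a (*-congʳ u₁≈a))) ⟩
      0# - ι a * (ι a * d)
        ≈⟨ solve 2 (λ a d → :0 :- a :* (a :* d) := (:- (a :* a)) :* d) refl (ι a) d ⟩
      (- (ι a * ι a)) * d       ≈⟨ *-congʳ (trans (ι.-‿homo _) (-‿cong (ι.*-homo a a))) ⟨
      ι (ℚ.- (a ℚ.* a)) * d     ∎
      where
      open SetoidReasoning setoid
      φ = λ ws → D (suc n) (shift u ∷ ws)
      d = D n (applyUpTo (shift ∘ shift ∘ R) m)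

  private
    minor₂ : (ℕ → Series) → ℕ → Series
    minor₂ T j i = T (suc (suc j)) (suc (suc i))

  record AntidiagonalBlocks (T : ℕ → Series) (h : ℕ → ℚ) : Set ℓ where
    field
      even-zero  : ∀ k i → i < suc (k ℕ.* 2) → T (k ℕ.* 2) i ≈ 0#
      even-value : ∀ k → T (k ℕ.* 2) (suc (k ℕ.* 2)) ≈ ι (h k)
      odd-zero   : ∀ k i → i < k ℕ.* 2 → T (suc (k ℕ.* 2)) i ≈ 0#
      odd-value  : ∀ k → T (suc (k ℕ.* 2)) (k ℕ.* 2) ≈ ι (h k)

  open AntidiagonalBlocks

  private
    below : ∀ {T : ℕ → Series} {h} → AntidiagonalBlocks T h → ∀ i → i < 2 → ∀ j → T (suc (suc j)) i ≈ 0#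
    below {T} T-blocks i i<2 = parity (λ j → T (suc (suc j)) i ≈ 0#)
      (λ k → even-zero T-blocks (suc k) i (ℕ.≤-trans i<2 (s≤s (s≤s z≤n))))
      (λ k → odd-zero T-blocks (suc k) i (ℕ.≤-trans i<2 (s≤s (s≤s z≤n))))

    blocks-tail : ∀ {T h} → AntidiagonalBlocks T h →
      AntidiagonalBlocks (minor₂ T) (h ∘ suc)
    blocks-tail T-blocks = record
      { even-zero  = λ k i i< → even-zero T-blocks (suc k) (suc (suc i)) (s<s (s<s i<))
      ; even-value = λ k → even-value T-blocks (suc k)
      ; odd-zero   = λ k i i< → odd-zero T-blocks (suc k) (suc (suc i)) (s<s (s<s i<))
      ; odd-value  = λ k → odd-value T-blocks (suc k)
      }

    blocks-step : ∀ {T h} → AntidiagonalBlocks T h → ∀ n →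
      D (suc (suc n)) (applyUpTo T (suc (suc n)))
        ≈ ι (ℚ.- (h 0 ℚ.* h 0)) * D n (applyUpTo (minor₂ T) n)
    blocks-step {T} {h} T-blocks n = expand-block n (T 0) (T 1) (λ j → T (suc (suc j))) n (h 0)
      (even-zero T-blocks 0 0 z<s) (even-value T-blocks 0) (odd-value T-blocks 0)
      (below T-blocks 0 z<s) (below T-blocks 1 (s<s z<s))

  blocks-even : ∀ {T h} → AntidiagonalBlocks T h → ∀ n →
    D (n ℕ.* 2) (applyUpTo T (n ℕ.* 2)) ≈ ι (∏< (λ k → ℚ.- (h k ℚ.* h k)) n)
  blocks-even T-blocks zero = sym ι.1#-homo
  blocks-even {T} {h} T-blocks (suc n) = begin
    D (suc n ℕ.* 2) (applyUpTo T (suc n ℕ.* 2))             ≈⟨ blocks-step T-blocks (n ℕ.* 2) ⟩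
    ι (h² 0) * D (n ℕ.* 2) (applyUpTo (minor₂ T) (n ℕ.* 2))
      ≈⟨ *-congˡ (blocks-even {minor₂ T} {h ∘ suc} (blocks-tail T-blocks) n) ⟩
    ι (h² 0) * ι (∏< (h² ∘ suc) n)                          ≈⟨ ι.*-homo _ _ ⟨
    ι (h² 0 ℚ.* ∏< (h² ∘ suc) n)                            ≡⟨ ≡.cong ι (∏<-first h² n) ⟨
    ι (∏< h² (suc n))                                       ∎
    where
    open SetoidReasoning setoid
    h² = λ k → ℚ.- (h k ℚ.* h k)

  -- With an odd number of columns the last block is cut down to its upper left corner, which is
  -- zero.
  blocks-odd : ∀ {T h} → AntidiagonalBlocks T h → ∀ n →
    D (suc (n ℕ.* 2)) (applyUpTo T (suc (n ℕ.* 2))) ≈ 0#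
  blocks-odd {T} T-blocks zero = trans (expand-skip (D 0) (T 0) [])
    (trans (*-identityʳ _) (even-zero T-blocks 0 0 z<s))
  blocks-odd {T} {h} T-blocks (suc n) = trans (blocks-step T-blocks (suc (n ℕ.* 2)))
    (trans (*-congˡ (blocks-odd {minor₂ T} {h ∘ suc} (blocks-tail T-blocks) n)) (zeroʳ _))

-- Orthogonal polynomials

N : ℕ → ℚ
N n = + n / 1

/-+ : ∀ m n → (m ℤ.+ n) / 1 ≡ m / 1 ℚ.+ n / 1
/-+ m n = ℚ.toℚᵘ-injective (begin
  ℚ.toℚᵘ ((m ℤ.+ n) / 1)  ≈⟨ ℚ.toℚᵘ-fromℚᵘ (ℚᵘ.mkℚᵘ (m ℤ.+ n) 0) ⟩
  ℚᵘ.mkℚᵘ (m ℤ.+ n) 0     ≡⟨ ≡.cong (λ k → ℚᵘ.mkℚᵘ k 0) (≡.cong₂ ℤ._+_ (ℤ.*-identityʳ m) (ℤ.*-identityʳ n)) ⟨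
  ℚᵘ.mkℚᵘ m 0 ℚᵘ.+ ℚᵘ.mkℚᵘ n 0
    ≈⟨ ℚᵘ.+-cong (ℚ.toℚᵘ-fromℚᵘ (ℚᵘ.mkℚᵘ m 0)) (ℚ.toℚᵘ-fromℚᵘ (ℚᵘ.mkℚᵘ n 0)) ⟨
  ℚ.toℚᵘ (m / 1) ℚᵘ.+ ℚ.toℚᵘ (n / 1) ≈⟨ ℚ.toℚᵘ-homo-+ (m / 1) (n / 1) ⟨
  ℚ.toℚᵘ (m / 1 ℚ.+ n / 1) ∎)
  where open SetoidReasoning ℚᵘ.≃-setoid

N-suc : ∀ n → N (suc n) ≡ 1ℚ ℚ.+ N n
N-suc n = /-+ (+ 1) (+ n)

module Recurrence (v α : ℚ) where
  open ℚ.+-*-Solver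

  -- Recurrence coefficients of the continuous dual Hahn polynomials with parameters
  -- (1 + u)/2, (1 - u)/2 and α, where v = (u/2)², in the variable (X - z)².
  β γ : ℕ → ℚ
  β m = v ℚ.- α ℚ.- + 1 / 4 ℚ.- N m ℚ.- (1ℚ ℚ.+ 1ℚ) ℚ.* N m ℚ.* (N m ℚ.+ α)
  γ m = N m ℚ.* N m ℚ.* ((N m ℚ.+ α ℚ.- ½) ℚ.* (N m ℚ.+ α ℚ.- ½) ℚ.- v)

  -- `κ k m` is (-1)^m m! k (k - 1) ... (k - m + 1).
  κ : ℕ → ℕ → ℚ
  κ k = ∏< (λ j → (1ℚ ℚ.+ N j) ℚ.* (N j ℚ.- N k))

-- For v = w² this is, up to the sign (-1)^n, the product of the rising factorials of length n of ρ
-- + w and ρ - w.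
Φ : ℚ → ℚ → ℕ → ℚ
Φ v ρ = ∏< (λ i → v ℚ.- (N i ℚ.+ ρ) ℚ.* (N i ℚ.+ ρ))

module _ (v α : ℚ) where
  open Recurrence v α
  open ℚ.+-*-Solver

  private
    κ-suc-suc : ∀ k m → κ (suc k) (suc m) ≡ ℚ.- ((1ℚ ℚ.+ N m) ℚ.* (1ℚ ℚ.+ N k)) ℚ.* κ k m
    κ-suc-suc k zero = ≡.trans (≡.cong (λ k′ → 1ℚ ℚ.* ((1ℚ ℚ.+ 0ℚ) ℚ.* (0ℚ ℚ.- k′))) (N-suc k))
      (solve 1 (λ k → con 1ℚ :* ((con 1ℚ :+ con 0ℚ) :* (con 0ℚ :- (con 1ℚ :+ k)))
                     := :- ((con 1ℚ :+ con 0ℚ) :* (con 1ℚ :+ k)) :* con 1ℚ) ≡.refl (N k))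
    κ-suc-suc k (suc m) = begin
      κ (suc k) (suc m) ℚ.* ((1ℚ ℚ.+ N (suc m)) ℚ.* (N (suc m) ℚ.- N (suc k)))
        ≡⟨ ≡.cong₂ (λ x k′ → x ℚ.* ((1ℚ ℚ.+ N (suc m)) ℚ.* (N (suc m) ℚ.- k′))) (κ-suc-suc k m) (N-suc k) ⟩
      x′ ℚ.* ((1ℚ ℚ.+ N (suc m)) ℚ.* (N (suc m) ℚ.- (1ℚ ℚ.+ N k)))
        ≡⟨ ≡.cong (λ m′ → x′ ℚ.* ((1ℚ ℚ.+ N (suc m)) ℚ.* (m′ ℚ.- (1ℚ ℚ.+ N k)))) (N-suc m) ⟩
      x′ ℚ.* ((1ℚ ℚ.+ N (suc m)) ℚ.* ((1ℚ ℚ.+ N m) ℚ.- (1ℚ ℚ.+ N k)))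
        ≡⟨ solve 4 (λ k m m′ x → (:- ((con 1ℚ :+ m) :* (con 1ℚ :+ k)) :* x) :* (m′ :* ((con 1ℚ :+ m) :- (con 1ℚ :+ k)))
                         := :- (m′ :* (con 1ℚ :+ k)) :* (x :* ((con 1ℚ :+ m) :* (m :- k))))
             ≡.refl (N k) (N m) (1ℚ ℚ.+ N (suc m)) (κ k m) ⟩
      ℚ.- ((1ℚ ℚ.+ N (suc m)) ℚ.* (1ℚ ℚ.+ N k)) ℚ.* κ k (suc m) ∎
      where
      open ≡.≡-Reasoning
      x′ = ℚ.- ((1ℚ ℚ.+ N m) ℚ.* (1ℚ ℚ.+ N k)) ℚ.* κ k m

    κ0≡0 : ∀ m → κ 0 (suc m) ≡ 0ℚ
    κ0≡0 zero    = ≡.refl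
    κ0≡0 (suc m) = ≡.trans (≡.cong (ℚ._* ((1ℚ ℚ.+ N (suc m)) ℚ.* (N (suc m) ℚ.- N 0))) (κ0≡0 m))
      (ℚ.*-zeroˡ ((1ℚ ℚ.+ N (suc m)) ℚ.* (N (suc m) ℚ.- N 0)))

  -- The value of the functional on C_k P_m (h is its value on 1); κ k m vanishes for k < m.
  W W⁻ : ℚ → ℕ → ℕ → ℚ
  W h m k = h ℚ.* (κ k m ℚ.* Φ v (α ℚ.+ ½) k)
  W⁻ h zero    k = 0ℚ
  W⁻ h (suc m) k = W h m k

  W-zero : ∀ h m → W h (suc m) 0 ≡ 0ℚ
  W-zero h m = ≡.trans (≡.cong (λ x → h ℚ.* (x ℚ.* 1ℚ)) (κ0≡0 m)) (ℚ.*-zeroʳ h)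

  -- The recurrence P_(m+1) = ((X - z)² - β m) P_m - γ m P_(m-1) tested against C_k, where (X - z)²
  -- C_k = C_(k+1) + (k + α)² C_k. After `κ-suc-suc` all terms have a common factor, and what
  -- remains is the polynomial identity that β and γ are chosen to satisfy.
  W-suc : ∀ h m k → W h (suc m) k ≡
    W h m (suc k) ℚ.+ (N k ℚ.+ α) ℚ.* (N k ℚ.+ α) ℚ.* W h m k ℚ.- β m ℚ.* W h m k ℚ.- γ m ℚ.* W⁻ h m k
  W-suc h zero k =
    solve 5 (λ h v α k φ → h :* (con 1ℚ :* ((con 1ℚ :+ con 0ℚ) :* (con 0ℚ :- k)) :* φ) :=
        h :* (con 1ℚ :* (φ :* (v :- (k :+ (α :+ con ½)) :* (k :+ (α :+ con ½)))))
        :+ (k :+ α) :* (k :+ α) :* (h :* (con 1ℚ :* φ))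
        :- (v :- α :- con (+ 1 / 4) :- con 0ℚ :- (con 1ℚ :+ con 1ℚ) :* con 0ℚ :* (con 0ℚ :+ α)) :* (h :* (con 1ℚ :* φ))
        :- (con 0ℚ :* con 0ℚ :* ((con 0ℚ :+ α :- con ½) :* (con 0ℚ :+ α :- con ½) :- v)) :* con 0ℚ)
      ≡.refl h v α (N k) (Φ v (α ℚ.+ ½) k)
  W-suc h (suc m) k = begin
    lhs (N (suc m))                     ≡⟨ ≡.cong lhs (N-suc m) ⟩
    lhs (1ℚ ℚ.+ N m)
      ≡⟨ solve 7 (λ h v α m k φ x → let m₁ = con 1ℚ :+ m ; y = x :* (m₁ :* (m :- k)) in
           h :* ((y :* ((con 1ℚ :+ m₁) :* (m₁ :- k))) :* φ) :=
           h :* ((:- (m₁ :* (con 1ℚ :+ k)) :* x) :* (φ :* (v :- (k :+ (α :+ con ½)) :* (k :+ (α :+ con ½)))))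
           :+ (k :+ α) :* (k :+ α) :* (h :* (y :* φ))
           :- (v :- α :- con (+ 1 / 4) :- m₁ :- (con 1ℚ :+ con 1ℚ) :* m₁ :* (m₁ :+ α)) :* (h :* (y :* φ))
           :- (m₁ :* m₁ :* ((m₁ :+ α :- con ½) :* (m₁ :+ α :- con ½) :- v)) :* (h :* (x :* φ)))
         ≡.refl h v α (N m) (N k) (Φ v (α ℚ.+ ½) k) (κ k m) ⟩
    rhs (1ℚ ℚ.+ N m) (ℚ.- ((1ℚ ℚ.+ N m) ℚ.* (1ℚ ℚ.+ N k)) ℚ.* κ k m)
      ≡⟨ ≡.cong₂ rhs (N-suc m) (κ-suc-suc k m) ⟨
    rhs (N (suc m)) (κ (suc k) (suc m)) ∎
    where
    open ≡.≡-Reasoning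
    lhs : ℚ → ℚ
    lhs n = h ℚ.* (κ k (suc m) ℚ.* ((1ℚ ℚ.+ n) ℚ.* (n ℚ.- N k)) ℚ.* Φ v (α ℚ.+ ½) k)
    rhs : ℚ → ℚ → ℚ
    rhs n x = h ℚ.* (x ℚ.* Φ v (α ℚ.+ ½) (suc k)) ℚ.+ (N k ℚ.+ α) ℚ.* (N k ℚ.+ α) ℚ.* W h (suc m) k
      ℚ.- (v ℚ.- α ℚ.- + 1 / 4 ℚ.- n ℚ.- (1ℚ ℚ.+ 1ℚ) ℚ.* n ℚ.* (n ℚ.+ α)) ℚ.* W h (suc m) k
      ℚ.- (n ℚ.* n ℚ.* ((n ℚ.+ α ℚ.- ½) ℚ.* (n ℚ.+ α ℚ.- ½) ℚ.- v)) ℚ.* W h m k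

module Operators {c ℓ} (A : ℚAlgebra c ℓ) where
  open ℚAlgebra A
  open AlgebraSolver A
  open SequenceModule A

  record Linear (T : Series → Series) : Set (c Level.⊔ ℓ) where
    field
      congruent : ∀ {f g} → f ≋ g → T f ≋ T g
      linear    : ∀ f k g → T (f ⊕ k ⊙ g) ≋ T f ⊕ k ⊙ T g

    scaling : ∀ k f → T (k ⊙ f) ≋ k ⊙ T f
    scaling k f n = trans (congruent (λ m → solve 2 (λ k f → k :* f := f :+ (k :- :1) :* f) refl k (f m)) n)
      (trans (linear f (k - 1#) f n) (solve 2 (λ k f → f :+ (k :- :1) :* f := k :* f) refl k (T f n)))

  open Linear public

  ∘-linear : ∀ {S T} → Linear S → Linear T → Linear (S ∘ T)
  ∘-linear S-lin T-lin = record
    { congruent = congruent S-lin ∘ congruent T-lin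
    ; linear    = λ f k g n → trans (congruent S-lin (linear T-lin f k g) n) (linear S-lin _ k _ n)
    }

  id-linear : Linear id
  id-linear = record { congruent = id ; linear = λ _ _ _ _ → refl }

  ⊙-linear : ∀ k → Linear (k ⊙_)
  ⊙-linear k = record
    { congruent = λ f≋g n → *-congˡ (f≋g n)
    ; linear    = λ f a g n → solve 4 (λ k f a g → k :* (f :+ a :* g) := k :* f :+ a :* (k :* g)) refl k (f n) a (g n)
    }

  ⊕-linear : ∀ {S T} → Linear S → Linear T → Linear (λ f → S f ⊕ T f)
  ⊕-linear S-lin T-lin = record
    { congruent = λ f≋g n → +-cong (congruent S-lin f≋g n) (congruent T-lin f≋g n)
    ; linear    = λ f k g n → trans (+-cong (linear S-lin f k g n) (linear T-lin f k g n))
        (solve 5 (λ a k b c d → (a :+ k :* b) :+ (c :+ k :* d) := (a :+ c) :+ k :* (b :+ d)) refl _ k _ _ _)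
    }

  shift-linear : Linear shift
  shift-linear = record { congruent = λ f≋g n → f≋g (suc n) ; linear = λ _ _ _ _ → refl }

  -- A sequence μ is read as the linear functional on polynomials with moments μ; multiplying the
  -- argument of the functional by X becomes a shift, and the value at 1 is μ 0.  Z c stands for X - c.
  Z : Carrier → Series → Series
  Z a f = shift f ⊕ (- a) ⊙ f

  Z-linear : ∀ a → Linear (Z a)
  Z-linear a = ⊕-linear shift-linear (⊙-linear (- a))

  -- Multiplication by (X - z)² - s.
  Quad : Carrier → Carrier → Series → Series
  Quad z s f = Z z (Z z f) ⊕ (- s) ⊙ f

  Quad-linear : ∀ z s → Linear (Quad z s)
  Quad-linear z s = ⊕-linear (∘-linear (Z-linear z) (Z-linear z)) (⊙-linear (- s))

  sq : ℚ → Carrier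
  sq q = ι (q ℚ.* q)

  -- Multiplication by ∏_{i<k} ((X - z)² - (i + α)²).
  C : Carrier → ℚ → ℕ → Series → Series
  C z α zero    f = f
  C z α (suc k) f = C z α k (Quad z (sq (N k ℚ.+ α)) f)

  C-linear : ∀ z α k → Linear (C z α k)
  C-linear z α zero    = id-linear
  C-linear z α (suc k) = ∘-linear (C-linear z α k) (Quad-linear z _)

  C-Z² : ∀ z α k f → C z α k (Z z (Z z f)) ≋ C z α (suc k) f ⊕ sq (N k ℚ.+ α) ⊙ C z α k f
  C-Z² z α k f n = sym (trans (+-congʳ (linear (C-linear z α k) (Z z (Z z f)) (- s) f n))
    (solve 3 (λ a s b → (a :+ (:- s) :* b) :+ s :* b := a) refl _ s _))
    where s = sq (N k ℚ.+ α)

  Zpow : Carrier → ℕ → Series → Series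
  Zpow z zero    f = f
  Zpow z (suc l) f = Zpow z l (Z z f)

  Zpow-linear : ∀ z l → Linear (Zpow z l)
  Zpow-linear z zero    = id-linear
  Zpow-linear z (suc l) = ∘-linear (Zpow-linear z l) (Z-linear z)

  -- The change from powers of X - z to powers of X is unitriangular, so vanishing below degree n
  -- and the value in degree n carry over.
  leading-moment : ∀ z n f → (∀ l → l < n → Zpow z l f 0 ≈ 0#) →
    (∀ i → i < n → f i ≈ 0#) × f n ≈ Zpow z n f 0
  leading-moment z zero    f low = (λ _ ()) , refl
  leading-moment z (suc n) f low = f≈0 , trans (f-suc n (f≈0 n ℕ.≤-refl)) (proj₂ rec)
    where
    rec = leading-moment z n (Z z f) (λ l l<n → low (suc l) (s<s l<n))
    f-suc : ∀ i → f i ≈ 0# → f (suc i) ≈ Z z f i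
    f-suc i fi≈0 = sym (trans (+-congˡ (trans (*-congˡ fi≈0) (zeroʳ _))) (+-identityʳ _))
    f≈0 : ∀ i → i < suc n → f i ≈ 0#
    f≈0 zero    _         = low 0 z<s
    f≈0 (suc i) (s≤s i<n) = trans (f-suc i (f≈0 i (ℕ.m≤n⇒m≤1+n i<n))) (proj₁ rec i i<n)

  module Polynomials (z : Carrier) (v α : ℚ) where
    open Recurrence v α

    mutual
      -- `P m f` is the functional f with its argument multiplied by P_m; `P⁻` belongs to the
      -- preceding polynomial, which is 0 for m = 0.
      P : ℕ → Series → Series
      P zero    f = f
      P (suc m) f = (Z z (Z z (P m f)) ⊕ (- ι (β m)) ⊙ P m f) ⊕ (- ι (γ m)) ⊙ P⁻ m f

      P⁻ : ℕ → Series → Series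
      P⁻ zero    f = 𝟘
      P⁻ (suc m) f = P m f

    Z²P : ∀ m f → Z z (Z z (P m f)) ≋ (P (suc m) f ⊕ ι (β m) ⊙ P m f) ⊕ ι (γ m) ⊙ P⁻ m f
    Z²P m f n = solve 5 (λ p b q g r → p := (((p :+ (:- b) :* q) :+ (:- g) :* r) :+ b :* q) :+ g :* r)
      refl _ (ι (β m)) (P m f n) (ι (γ m)) (P⁻ m f n)

    linear-P-suc : ∀ {T} → Linear T → ∀ m f →
      T (P (suc m) f) ≋ (T (Z z (Z z (P m f))) ⊕ (- ι (β m)) ⊙ T (P m f)) ⊕ (- ι (γ m)) ⊙ T (P⁻ m f)
    linear-P-suc T-lin m f n = trans (linear T-lin _ _ _ n) (+-congʳ (linear T-lin _ _ _ n))

    linear-Z²P : ∀ {T} → Linear T → ∀ m f →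
      T (Z z (Z z (P m f))) ≋ (T (P (suc m) f) ⊕ ι (β m) ⊙ T (P m f)) ⊕ ι (γ m) ⊙ T (P⁻ m f)
    linear-Z²P T-lin m f n = trans (congruent T-lin (Z²P m f) n)
      (trans (linear T-lin _ _ _ n) (+-congʳ (linear T-lin _ _ _ n)))

    linear-𝟘 : ∀ {T} → Linear T → T 𝟘 ≋ 𝟘
    linear-𝟘 T-lin n = trans (congruent T-lin {g = 0# ⊙ 𝟘} (λ _ → sym (zeroˡ _)) n)
      (trans (scaling T-lin 0# 𝟘 n) (zeroˡ _))

    mutual
      Z-P : ∀ m f → Z z (P m f) ≋ P m (Z z f)
      Z-P zero    f n = refl
      Z-P (suc m) f n = trans (linear-P-suc (Z-linear z) m f n)
        (+-cong (+-cong (congruent (∘-linear (Z-linear z) (Z-linear z)) (Z-P m f) n) (*-congˡ (Z-P m f n)))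
                (*-congˡ (Z-P⁻ m f n)))

      Z-P⁻ : ∀ m f → Z z (P⁻ m f) ≋ P⁻ m (Z z f)
      Z-P⁻ zero    f = linear-𝟘 (Z-linear z)
      Z-P⁻ (suc m) f = Z-P m f

    EvenVanishing : Series → Set ℓ
    EvenVanishing f = ∀ i → Zpow z (i ℕ.* 2) f 0 ≈ 0#

    mutual
      -- P_m is even in X - z, so multiplication by it keeps even polynomials even.
      P-vanishing : ∀ {f} → EvenVanishing f → ∀ m → EvenVanishing (P m f)
      P-vanishing f-even zero    = f-even
      P-vanishing f-even (suc m) i = trans (linear-P-suc (Zpow-linear z (i ℕ.* 2)) m _ 0)
        (trans (+-cong (+-cong (P-vanishing f-even m (suc i)) (trans (*-congˡ (P-vanishing f-even m i)) (zeroʳ _)))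
                       (trans (*-congˡ (P⁻-vanishing f-even m i)) (zeroʳ _)))
               (trans (+-identityʳ _) (+-identityʳ _)))

      P⁻-vanishing : ∀ {f} → EvenVanishing f → ∀ m → EvenVanishing (P⁻ m f)
      P⁻-vanishing f-even zero    i = linear-𝟘 (Zpow-linear z (i ℕ.* 2)) 0
      P⁻-vanishing f-even (suc m)   = P-vanishing f-even m

    module _ (f : Series) (h : ℚ) (C-value : ∀ k → C z α k f 0 ≈ ι (h ℚ.* Φ v (α ℚ.+ ½) k)) where

      mutual
        -- Induction on m for all k at once: the step multiplies by (X - z)², which raises k by one
        -- (`C-Z²`). The closed form follows by `W-suc`.
        C-P : ∀ m k → C z α k (P m f) 0 ≈ ι (W v α h m k)
        C-P zero    k = trans (C-value k)
          (ι.⟦⟧-cong (≡.cong (h ℚ.*_) (≡.sym (ℚ.*-identityˡ (Φ v (α ℚ.+ ½) k)))))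
        C-P (suc m) k = begin
          C z α k (P (suc m) f) 0
            ≈⟨ linear-P-suc (C-linear z α k) m f 0 ⟩
          (C z α k (Z z (Z z (P m f))) 0 + (- ι (β m)) * C z α k (P m f) 0) + (- ι (γ m)) * C z α k (P⁻ m f) 0
            ≈⟨ +-cong (+-cong (trans (C-Z² z α k (P m f) 0) (+-cong (C-P m (suc k)) (*-congˡ (C-P m k))))
                              (*-congˡ (C-P m k)))
                      (*-congˡ (C-P⁻ m k)) ⟩
          ((ι w₁ + ι s * ι w) + (- ι (β m)) * ι w) + (- ι (γ m)) * ι w⁻
            ≈⟨ solve 6 (λ w₁ s w b g w⁻ → ((w₁ :+ s :* w) :+ (:- b) :* w) :+ (:- g) :* w⁻
                  := ((w₁ :+ s :* w) :- b :* w) :- g :* w⁻) refl (ι w₁) (ι s) (ι w) (ι (β m)) (ι (γ m)) (ι w⁻) ⟩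
          ((ι w₁ + ι s * ι w) - ι (β m) * ι w) - ι (γ m) * ι w⁻
            ≈⟨ trans (ι-- _ _) (+-cong (trans (ι-- _ _) (+-cong (trans (ι.+-homo _ _) (+-congˡ (ι.*-homo _ _)))
                                                              (-‿cong (ι.*-homo _ _))))
                                      (-‿cong (ι.*-homo _ _))) ⟨
          ι (w₁ ℚ.+ s ℚ.* w ℚ.- β m ℚ.* w ℚ.- γ m ℚ.* w⁻)   ≡⟨ ≡.cong ι (W-suc v α h m k) ⟨
          ι (W v α h (suc m) k) ∎
          where
          open SetoidReasoning setoid
          w₁ = W v α h m (suc k)
          w  = W v α h m k
          w⁻ = W⁻ v α h m k
          s  = (N k ℚ.+ α) ℚ.* (N k ℚ.+ α)
          ι-- : ∀ p q → ι (p ℚ.- q) ≈ ι p - ι q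
          ι-- p q = trans (ι.+-homo _ _) (+-congˡ (ι.-‿homo q))

        C-P⁻ : ∀ m k → C z α k (P⁻ m f) 0 ≈ ι (W⁻ v α h m k)
        C-P⁻ zero    k = trans (linear-𝟘 (C-linear z α k) 0) (sym ι.0#-homo)
        C-P⁻ (suc m) k = C-P m k

      -- Only the value on 1 is taken from the closed form. Each further (X - z)² is absorbed by the
      -- recurrence, which lowers the index of P by at most one, so i < m is maintained.
      orthogonal : ∀ i m → i < m → Zpow z (i ℕ.* 2) (P m f) 0 ≈ 0#
      orthogonal zero (suc m) _ = trans (C-P (suc m) 0)
        (trans (ι.⟦⟧-cong (W-zero v α h m)) ι.0#-homo)
      orthogonal (suc i) (suc m) (s≤s i<m) = trans (linear-Z²P (Zpow-linear z (i ℕ.* 2)) (suc m) f 0)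
        (trans (+-cong (+-cong (orthogonal i (suc (suc m)) (ℕ.m≤n⇒m≤1+n (ℕ.m≤n⇒m≤1+n i<m)))
                               (trans (*-congˡ (orthogonal i (suc m) (ℕ.m≤n⇒m≤1+n i<m))) (zeroʳ _)))
                       (trans (*-congˡ (orthogonal i m i<m)) (zeroʳ _)))
               (trans (+-identityʳ _) (+-identityʳ _)))

      -- Of the three terms of (X - z)² P_(m+1), two vanish against (X - z)^(2m) by orthogonality;
      -- the third contributes γ (m + 1).
      norm : ∀ m → Zpow z (m ℕ.* 2) (P m f) 0 ≈ ι (h ℚ.* ∏< (γ ∘ suc) m)
      norm zero = C-value 0
      norm (suc m) = trans (linear-Z²P (Zpow-linear z (m ℕ.* 2)) (suc m) f 0)
        (trans (+-cong (trans (+-cong (orthogonal m (suc (suc m)) (ℕ.m≤n⇒m≤1+n ℕ.≤-refl))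
                                      (trans (*-congˡ (orthogonal m (suc m) ℕ.≤-refl)) (zeroʳ _)))
                              (+-identityʳ _))
                       (*-congˡ (norm m)))
        (trans (+-identityˡ _) (trans (sym (ι.*-homo _ _)) (ι.⟦⟧-cong
          (≡.trans (ℚ.*-comm (γ (suc m)) (h ℚ.* ∏< (γ ∘ suc) m)) (ℚ.*-assoc h (∏< (γ ∘ suc) m) (γ (suc m))))))))

    module _ (w : ℕ → Series) (shift-w : ∀ n → shift (w n) ≋ w (suc n)) where
      open ColumnExpansion A

      Z-monic : ∀ n {f} → Monic w n f → Monic w (suc n) (Z z f)
      Z-monic n f-monic = monic-add w (suc n) (- z) (monic-shift w shift-w n f-monic) (monic-span w n f-monic)

      P-monic : ∀ n {f} → Monic w n f → ∀ m → Monic w (m ℕ.* 2 ℕ.+ n) (P m f)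
      P-monic n f-monic zero    = f-monic
      P-monic n {f} f-monic (suc m) =
        monic-add w _ _ (monic-add w _ _ (Z-monic _ (Z-monic _ (P-monic n f-monic m)))
                                         (span-suc w _ (monic-span w _ (P-monic n f-monic m))))
                        (P⁻-span m)
        where
        P⁻-span : ∀ m → InSpan w (suc (suc (m ℕ.* 2 ℕ.+ n))) (P⁻ m f)
        P⁻-span zero    = zero-span w _ (λ _ → refl)
        P⁻-span (suc m) = span-suc w _ (span-suc w _ (span-suc w _ (monic-span w _ (P-monic n f-monic m))))

  -- The hypothesis for all k passes from f to (X - z)² f by `C-Z²`, and its case k = 0 is the
  -- moment wanted.
  C-vanishing : ∀ z α {f} → (∀ k → C z α k f 0 ≈ 0#) → ∀ i → Zpow z (i ℕ.* 2) f 0 ≈ 0#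
  C-vanishing z α f≈0 zero    = f≈0 0
  C-vanishing z α {f} f≈0 (suc i) = C-vanishing z α (λ k → trans (C-Z² z α k f 0)
    (trans (+-cong (f≈0 (suc k)) (trans (*-congˡ (f≈0 k)) (zeroʳ _))) (+-identityʳ _))) i

-- Arithmetic of fractions with integer numerator and natural denominator

/-*-N : ∀ a n .{{_ : NonZero n}} → a / n ℚ.* N n ≡ a / 1
/-*-N a (suc n) = ℚ.toℚᵘ-injective (begin
  ℚ.toℚᵘ (a / suc n ℚ.* N (suc n))            ≈⟨ ℚ.toℚᵘ-homo-* (a / suc n) (N (suc n)) ⟩
  ℚ.toℚᵘ (a / suc n) ℚᵘ.* ℚ.toℚᵘ (N (suc n))
    ≈⟨ ℚᵘ.*-cong (ℚ.toℚᵘ-fromℚᵘ (ℚᵘ.mkℚᵘ a n)) (ℚ.toℚᵘ-fromℚᵘ (ℚᵘ.mkℚᵘ (+ suc n) 0)) ⟩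
  ℚᵘ.mkℚᵘ a n ℚᵘ.* ℚᵘ.mkℚᵘ (+ suc n) 0        ≈⟨ ℚᵘ.*≡* (≡.trans (ℤ.*-identityʳ _)
                                                   (≡.cong (λ k → a ℤ.* + k) (≡.sym (ℕ.*-identityʳ (suc n))))) ⟩
  ℚᵘ.mkℚᵘ a 0                                 ≈⟨ ℚ.toℚᵘ-fromℚᵘ (ℚᵘ.mkℚᵘ a 0) ⟨
  ℚ.toℚᵘ (a / 1)                              ∎)
  where open SetoidReasoning ℚᵘ.≃-setoid

N-cancel : ∀ n .{{_ : NonZero n}} {p q} → p ℚ.* N n ≡ q ℚ.* N n → p ≡ q
N-cancel n {p} {q} pn≡qn = ≡.trans (≡.sym (inv p)) (≡.trans (≡.cong (ℚ._* (+ 1 / n)) pn≡qn) (inv q))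
  where
  inv : ∀ p → p ℚ.* N n ℚ.* (+ 1 / n) ≡ p
  inv p = ≡.trans (ℚ.*-assoc p (N n) (+ 1 / n)) (≡.trans
    (≡.cong (p ℚ.*_) (≡.trans (ℚ.*-comm (N n) (+ 1 / n)) (/-*-N (+ 1) n))) (ℚ.*-identityʳ p))

/-N : ∀ a n .{{_ : NonZero n}} → a / n ≡ a / 1 ℚ.* (+ 1 / n)
/-N a n = N-cancel n (≡.trans (/-*-N a n) (≡.sym (≡.trans (ℚ.*-assoc (a / 1) (+ 1 / n) (N n))
  (≡.trans (≡.cong (a / 1 ℚ.*_) (/-*-N (+ 1) n)) (ℚ.*-identityʳ (a / 1))))))

N-* : ∀ m n → N (m ℕ.* n) ≡ N m ℚ.* N n
N-* m n = ℚ.toℚᵘ-injective (begin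
  ℚ.toℚᵘ (N (m ℕ.* n))        ≈⟨ ℚ.toℚᵘ-fromℚᵘ (ℚᵘ.mkℚᵘ (+ (m ℕ.* n)) 0) ⟩
  ℚᵘ.mkℚᵘ (+ (m ℕ.* n)) 0     ≡⟨ ≡.cong (λ k → ℚᵘ.mkℚᵘ k 0) (ℤ.pos-* m n) ⟩
  ℚᵘ.mkℚᵘ (+ m) 0 ℚᵘ.* ℚᵘ.mkℚᵘ (+ n) 0
    ≈⟨ ℚᵘ.*-cong (ℚ.toℚᵘ-fromℚᵘ (ℚᵘ.mkℚᵘ (+ m) 0)) (ℚ.toℚᵘ-fromℚᵘ (ℚᵘ.mkℚᵘ (+ n) 0)) ⟨
  ℚ.toℚᵘ (N m) ℚᵘ.* ℚ.toℚᵘ (N n) ≈⟨ ℚ.toℚᵘ-homo-* (N m) (N n) ⟨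
  ℚ.toℚᵘ (N m ℚ.* N n) ∎)
  where open SetoidReasoning ℚᵘ.≃-setoid

N-+ : ∀ m n → N (m ℕ.+ n) ≡ N m ℚ.+ N n
N-+ m n = /-+ (+ m) (+ n)

N-double : ∀ k → N (k ℕ.* 2) ≡ N k ℚ.+ N k
N-double k = ≡.trans (≡.cong N (≡.trans (ℕ.*-comm k 2) (≡.cong (k ℕ.+_) (ℕ.+-identityʳ k)))) (N-+ k k)

-- The functional with moments E_k(y)

module Convolution {c ℓ} (A : ℚAlgebra c ℓ) where
  open ℚAlgebra A
  open SemiringSum semiring using (sum; sum-cong-≋; *-distribˡ-sum; ∑-distrib-+)

  -- Terms depend on both i and j = n - i, so that the truncated subtraction stays inside and
  -- `S-cong` offers i + j = n instead.
  S : ℕ → (ℕ → ℕ → Carrier) → Carrier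
  S n g = sum {suc n} (λ i → g (toℕ i) (n ∸ toℕ i))

  S-cong : ∀ n {g h} → (∀ i j → i ℕ.+ j ≡ n → g i j ≈ h i j) → S n g ≈ S n h
  S-cong n g≈h = sum-cong-≋ {suc n} λ i → g≈h (toℕ i) (n ∸ toℕ i) (ℕ.m+[n∸m]≡n (toℕ≤pred[n] i))

  S-last : ∀ n g → S (suc n) g ≈ S n (λ i j → g i (suc j)) + g (suc n) 0
  S-last zero    g = trans (+-congˡ (+-identityʳ _)) (+-congʳ (sym (+-identityʳ _)))
  S-last (suc n) g = trans (+-congˡ (S-last n (λ i j → g (suc i) j))) (sym (+-assoc _ _ _))

  S-+ : ∀ n g h → S n (λ i j → g i j + h i j) ≈ S n g + S n h
  S-+ n g h = ∑-distrib-+ {suc n} (λ i → g (toℕ i) (n ∸ toℕ i)) (λ i → h (toℕ i) (n ∸ toℕ i))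

  S-* : ∀ n a g → a * S n g ≈ S n (λ i j → a * g i j)
  S-* n a g = *-distribˡ-sum {suc n} a (λ i → g (toℕ i) (n ∸ toℕ i))

module EulerFunctional {c ℓ} (A : ℚAlgebra c ℓ) where
  open ℚAlgebra A
  open AlgebraSolver A
  open SequenceModule A
  open Operators A
  open Convolution A
  open Euler A using (1/_!; exp; E; E-generatingFunction)
  open PowerSeries commutativeRing using (constant)
  open SemiringExp semiring using (_^_)

  private
    /!-inverse : ∀ n → (1/ n !) ℚ.* N (n !) ≡ 1ℚ
    /!-inverse n = /-*-N (+ 1) (n !) {{n ℕ.!≢0}}

    /!-suc : ∀ n → N (suc n) ℚ.* (1/ suc n !) ≡ 1/ n !
    /!-suc n = begin
      x                              ≡⟨ ℚ.*-identityˡ x ⟨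
      1ℚ ℚ.* x                       ≡⟨ ≡.cong (ℚ._* x) (/!-inverse n) ⟨
      (1/ n !) ℚ.* N (n !) ℚ.* x     ≡⟨ ℚ.*-assoc (1/ n !) (N (n !)) x ⟩
      (1/ n !) ℚ.* (N (n !) ℚ.* x)   ≡⟨ ≡.cong ((1/ n !) ℚ.*_) Nx≡1 ⟩
      (1/ n !) ℚ.* 1ℚ                ≡⟨ ℚ.*-identityʳ (1/ n !) ⟩
      1/ n !                         ∎
      where
      open ≡.≡-Reasoning
      x = N (suc n) ℚ.* (1/ suc n !)
      Nx≡1 : N (n !) ℚ.* x ≡ 1ℚ
      Nx≡1 = begin
        N (n !) ℚ.* (N (suc n) ℚ.* (1/ suc n !))  ≡⟨ ℚ.*-assoc (N (n !)) (N (suc n)) (1/ suc n !) ⟨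
        N (n !) ℚ.* N (suc n) ℚ.* (1/ suc n !)
          ≡⟨ ≡.cong (ℚ._* (1/ suc n !)) (≡.trans (ℚ.*-comm (N (n !)) (N (suc n))) (≡.sym (N-* (suc n) (n !)))) ⟩
        N (suc n !) ℚ.* (1/ suc n !)              ≡⟨ ℚ.*-comm (N (suc n !)) (1/ suc n !) ⟩
        (1/ suc n !) ℚ.* N (suc n !)              ≡⟨ /!-inverse (suc n) ⟩
        1ℚ                                        ∎

  -- The functional f(X) ↦ μ(f(X + 1)): its moments are the binomial transform of μ.
  τ : Series → Series
  τ f zero    = f 0
  τ f (suc n) = τ (shift f ⊕ f) n

  τ-linear : Linear τ
  τ-linear = record { congruent = cong′ ; linear = λ f k g n → lin n f k g }
    where
    cong′ : ∀ {f g} → f ≋ g → τ f ≋ τ g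
    cong′ f≋g zero    = f≋g 0
    cong′ f≋g (suc n) = cong′ (λ m → +-cong (f≋g (suc m)) (f≋g m)) n
    lin : ∀ n f k g → τ (f ⊕ k ⊙ g) n ≈ τ f n + k * τ g n
    lin zero    f k g = refl
    lin (suc n) f k g = trans
      (cong′ (λ m → solve 5 (λ a k b c d → (a :+ k :* b) :+ (c :+ k :* d) := (a :+ c) :+ k :* (b :+ d))
                      refl (f (suc m)) k (g (suc m)) (f m) (g m)) n)
      (lin n (shift f ⊕ f) k (shift g ⊕ g))

  private
    F : Series → ℕ → ℕ → Carrier
    F μ i j = ι (1/ i !) * μ i * exp 1# j

    -- The product rule for e^t times the exponential generating function of μ: n + 1 splits as i +
    -- j, the derivative of the generating function is that of `shift μ`, and e^t is its own
    -- derivative.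
    leibniz : ∀ μ n → ι (N (suc n)) * S (suc n) (F μ) ≈ S n (F (shift μ)) + S n (F μ)
    leibniz μ n = begin
      ι (N (suc n)) * S (suc n) (F μ)                     ≈⟨ S-* (suc n) _ (F μ) ⟩
      S (suc n) (λ i j → ι (N (suc n)) * F μ i j)         ≈⟨ S-cong (suc n) {h = λ i j → G i j + K i j} split ⟩
      S (suc n) (λ i j → G i j + K i j)                   ≈⟨ S-+ (suc n) G K ⟩
      S (suc n) G + S (suc n) K
        ≈⟨ +-cong (trans (+-congʳ (trans (*-congʳ ι.0#-homo) (zeroˡ _))) (+-identityˡ _))
                  (trans (S-last n K) (trans (+-congˡ (trans (*-congʳ ι.0#-homo) (zeroˡ _))) (+-identityʳ _))) ⟩
      S n (λ i j → G (suc i) j) + S n (λ i j → K i (suc j))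
        ≈⟨ +-cong (S-cong n {h = F (shift μ)} λ i j _ → G-suc i j) (S-cong n {h = F μ} λ i j _ → K-suc i j) ⟩
      S n (F (shift μ)) + S n (F μ)                       ∎
      where
      open SetoidReasoning setoid
      G K : ℕ → ℕ → Carrier
      G i j = ι (N i) * F μ i j
      K i j = ι (N j) * F μ i j
      split : ∀ i j → i ℕ.+ j ≡ suc n → ι (N (suc n)) * F μ i j ≈ G i j + K i j
      split i j i+j≡ = trans (*-congʳ (trans (ι.⟦⟧-cong (≡.trans (≡.cong N (≡.sym i+j≡)) (N-+ i j))) (ι.+-homo _ _)))
        (distribʳ _ _ _)
      ι-/!-suc : ∀ i → ι (N (suc i)) * ι (1/ suc i !) ≈ ι (1/ i !)
      ι-/!-suc i = trans (sym (ι.*-homo _ _)) (ι.⟦⟧-cong (/!-suc i))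
      G-suc : ∀ i j → G (suc i) j ≈ F (shift μ) i j
      G-suc i j = trans (solve 4 (λ n f m e → n :* (f :* m :* e) := (n :* f) :* m :* e) refl
        (ι (N (suc i))) (ι (1/ suc i !)) (μ (suc i)) (exp 1# j)) (*-congʳ (*-congʳ (ι-/!-suc i)))
      K-suc : ∀ i j → K i (suc j) ≈ F μ i j
      K-suc i j = trans (solve 4 (λ n a f p → n :* (a :* (f :* (:1 :* p))) := a :* ((n :* f) :* p)) refl
        (ι (N (suc j))) (ι (1/ i !) * μ i) (ι (1/ suc j !)) (1# ^ j)) (*-congˡ (*-congʳ (ι-/!-suc j)))

    -- By `leibniz`, n! times the n-th coefficient obeys the recursion that defines `τ`, with μ
    -- changing along the way.
    convolution-τ : ∀ n μ → ι (N (n !)) * S n (F μ) ≈ τ μ n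
    convolution-τ zero μ = trans (*-cong ι.1#-homo (+-congʳ (*-cong (*-congʳ ι.1#-homo) (*-congʳ ι.1#-homo))))
      (solve 1 (λ a → :1 :* (:1 :* a :* (:1 :* :1) :+ :0) := a) refl (μ 0))
    convolution-τ (suc n) μ = begin
      ι (N (suc n !)) * S (suc n) (F μ)
        ≈⟨ *-congʳ (trans (ι.⟦⟧-cong (≡.trans (N-* (suc n) (n !)) (ℚ.*-comm (N (suc n)) (N (n !))))) (ι.*-homo _ _)) ⟩
      ι (N (n !)) * ι (N (suc n)) * S (suc n) (F μ)
        ≈⟨ trans (*-assoc _ _ _) (*-congˡ (leibniz μ n)) ⟩
      ι (N (n !)) * (S n (F (shift μ)) + S n (F μ))
        ≈⟨ trans (distribˡ _ _ _) (+-cong (convolution-τ n (shift μ)) (convolution-τ n μ)) ⟩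
      τ (shift μ) n + τ μ n                ≈⟨ +-congˡ (*-identityˡ _) ⟨
      τ (shift μ) n + 1# * τ μ n           ≈⟨ linear τ-linear (shift μ) 1# μ n ⟨
      τ (shift μ ⊕ 1# ⊙ μ) n               ≈⟨ congruent τ-linear (λ m → +-congˡ (*-identityˡ _)) n ⟩
      τ (shift μ ⊕ μ) n                    ∎
      where open SetoidReasoning setoid

    S-constant : ∀ n (a : Series) → S n (λ i j → a i * constant 1# j) ≈ a n
    S-constant zero    a = trans (+-identityʳ _) (*-identityʳ _)
    S-constant (suc n) a = trans (S-last n (λ i j → a i * constant 1# j))
      (trans (+-cong (trans (S-cong n {h = λ _ _ → 0# * 0#} (λ i j _ → trans (zeroʳ (a i)) (sym (zeroˡ 0#))))
                            (trans (sym (S-* n 0# (λ _ _ → 0#))) (zeroˡ _)))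
                     (*-identityʳ _))
             (+-identityˡ _))

  2# : Carrier
  2# = 1# + 1#

  ½-cancel : ∀ {a b} → 2# * a ≈ 2# * b → a ≈ b
  ½-cancel {a} {b} h = trans (halve a) (trans (*-congˡ h) (sym (halve b)))
    where
    halve : ∀ a → a ≈ ι ½ * (2# * a)
    halve = solve 1 (λ a → a := :½ :* ((:1 :+ :1) :* a)) refl

  pow : Carrier → Series
  pow y n = y ^ n

  𝓔 : Carrier → Series
  𝓔 y k = E k y

  -- Compares n! times the coefficients of t^n in the generating function identity: the factor e^t
  -- acts on moments as `τ`, the factor 1 as the identity.
  Euler-recurrence : ∀ y → τ (𝓔 y) ⊕ 1# ⊙ 𝓔 y ≋ 2# ⊙ pow y
  Euler-recurrence y n = begin
    τ (𝓔 y) n + 1# * 𝓔 y n                     ≈⟨ +-cong (convolution-τ n (𝓔 y)) n!a≈ ⟨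
    ι (N (n !)) * S n (F (𝓔 y)) + ι (N (n !)) * S n (λ i j → a i * constant 1# j)
                                                ≈⟨ trans (*-congˡ (S-+ n (F (𝓔 y)) (λ i j → a i * constant 1# j))) (distribˡ _ _ _) ⟨
    ι (N (n !)) * S n (λ i j → F (𝓔 y) i j + a i * constant 1# j)
      ≈⟨ *-congˡ (trans (S-cong n {h = λ i j → a i * (exp 1# j + constant 1# j)} (λ i j _ → sym (distribˡ _ _ _)))
                        (E-generatingFunction y n)) ⟩
    ι (N (n !)) * (ι (+ 2 / 1) * (ι (1/ n !) * y ^ n))
      ≈⟨ solve 4 (λ f t i p → f :* (t :* (i :* p)) := t :* ((i :* f) :* p)) refl
           (ι (N (n !))) (ι (+ 2 / 1)) (ι (1/ n !)) (y ^ n) ⟩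
    ι (+ 2 / 1) * ((ι (1/ n !) * ι (N (n !))) * y ^ n)
      ≈⟨ *-cong ι2≈2 (trans (*-congʳ /!-n!) (*-identityˡ _)) ⟩
    2# * y ^ n                                  ∎
    where
    open SetoidReasoning setoid
    a : Series
    a i = ι (1/ i !) * 𝓔 y i
    /!-n! : ι (1/ n !) * ι (N (n !)) ≈ 1#
    /!-n! = trans (sym (ι.*-homo _ _)) (trans (ι.⟦⟧-cong (/!-inverse n)) ι.1#-homo)
    ι2≈2 : ι (+ 2 / 1) ≈ 2#
    ι2≈2 = trans (ι.+-homo 1ℚ 1ℚ) (+-cong ι.1#-homo ι.1#-homo)
    n!a≈ : ι (N (n !)) * S n (λ i j → a i * constant 1# j) ≈ 1# * 𝓔 y n
    n!a≈ = trans (*-congˡ (S-constant n a))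
      (trans (solve 3 (λ f i e → f :* (i :* e) := (i :* f) :* e) refl (ι (N (n !))) (ι (1/ n !)) (𝓔 y n))
             (*-congʳ /!-n!))

-- Values of the Euler functional on central factorials

module CentralFactorials {c ℓ} (A : ℚAlgebra c ℓ) where
  open ℚAlgebra A
  open AlgebraSolver A
  open SequenceModule A
  open Operators A
  open EulerFunctional A
  open SemiringExp semiring using (_^_)

  ιN-suc : ∀ n → ι (N (suc n)) ≈ 1# + ι (N n)
  ιN-suc n = trans (ι.⟦⟧-cong (N-suc n)) (trans (ι.+-homo _ _) (+-congʳ ι.1#-homo))

  ιN-double : ∀ n → ι (N (n ℕ.* 2)) ≈ ι (N n) + ι (N n)
  ιN-double n = trans (ι.⟦⟧-cong (N-double n)) (ι.+-homo _ _)

  Z-cong : ∀ {a b} → a ≈ b → ∀ f → Z a f ≋ Z b f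
  Z-cong a≈b f n = +-congˡ (*-congʳ (-‿cong a≈b))

  Z-comm : ∀ a b f → Z a (Z b f) ≋ Z b (Z a f)
  Z-comm a b f n = solve 5 (λ a b f₀ f₁ f₂ → (f₂ :+ (:- b) :* f₁) :+ (:- a) :* (f₁ :+ (:- b) :* f₀)
      := (f₂ :+ (:- a) :* f₁) :+ (:- b) :* (f₁ :+ (:- a) :* f₀))
    refl a b (f n) (f (suc n)) (f (suc (suc n)))

  -- Multiplication by (X - a) (X - a - 1) ⋯ (X - a - r + 1).
  Π : ℕ → Carrier → Series → Series
  Π zero    a f = f
  Π (suc r) a f = Π r (a + 1#) (Z a f)

  Π-linear : ∀ r a → Linear (Π r a)
  Π-linear zero    a = id-linear
  Π-linear (suc r) a = ∘-linear (Π-linear r (a + 1#)) (Z-linear a)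

  Π-cong : ∀ r {a b} → a ≈ b → ∀ f → Π r a f ≋ Π r b f
  Π-cong zero    a≈b f n = refl
  Π-cong (suc r) a≈b f n = trans (Π-cong r (+-congʳ a≈b) _ n)
    (congruent (Π-linear r _) (Z-cong a≈b f) n)

  Π-last : ∀ r a f → Π (suc r) a f ≋ Π r a (Z (a + ι (N r)) f)
  Π-last zero    a f = Z-cong (sym (trans (+-congˡ ι.0#-homo) (+-identityʳ a))) f
  Π-last (suc r) a f n = trans (Π-last r (a + 1#) (Z a f) n)
    (congruent (Π-linear r (a + 1#))
      (λ m → trans (Z-cong (trans (+-assoc _ _ _) (+-congˡ (sym (ιN-suc r)))) (Z a f) m) (Z-comm (a + ι (N (suc r))) a f m)) n)

  -- Substituting X + 1 for X turns X - a into X - (a - 1).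
  Z-τ : ∀ a f → Z a (τ f) ≋ τ (Z (a - 1#) f)
  Z-τ a f n = trans (sym (linear τ-linear (shift f ⊕ f) (- a) f n))
    (congruent τ-linear (λ m → solve 3 (λ g f a → (g :+ f) :+ (:- a) :* f := g :+ (:- (a :- :1)) :* f)
                                 refl (f (suc m)) (f m) a) n)

  Π-τ : ∀ r a f → Π r (a + 1#) (τ f) ≋ τ (Π r a f)
  Π-τ zero    a f n = refl
  Π-τ (suc r) a f n = begin
    Π r (a + 1# + 1#) (Z (a + 1#) (τ f)) n
      ≈⟨ congruent (Π-linear r _) (λ m → trans (Z-τ (a + 1#) f m)
           (congruent τ-linear (Z-cong (solve 1 (λ a → a :+ :1 :- :1 := a) refl a) f) m)) n ⟩
    Π r (a + 1# + 1#) (τ (Z a f)) n        ≈⟨ Π-τ r (a + 1#) (Z a f) n ⟩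
    τ (Π r (a + 1#) (Z a f)) n             ∎
    where open SetoidReasoning setoid

  -- With f = X^{(r+1)} falling from a, f(X + 1) + f(X) = 2 (X - z) f(X)/(X - a - r).
  Euler-Π : ∀ {μ y} → τ μ ⊕ 1# ⊙ μ ≋ 2# ⊙ pow y →
    ∀ r {a z} → (a - 1#) + (a + ι (N r)) ≈ z + z → Π r a (Z z μ) 0 ≈ Π (suc r) a (pow y) 0
  Euler-Π {μ} {y} μ-rec r {a} {z} a≈z = ½-cancel (begin
    2# * Π r a (Z z μ) 0                    ≈⟨ scaling (Π-linear r a) 2# (Z z μ) 0 ⟨
    Π r a (2# ⊙ Z z μ) 0                    ≈⟨ congruent (Π-linear r a) average 0 ⟨
    Π r a (Z (a - 1#) μ ⊕ 1# ⊙ Z (a + ι (N r)) μ) 0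
      ≈⟨ linear (Π-linear r a) _ 1# _ 0 ⟩
    Π r a (Z (a - 1#) μ) 0 + 1# * Π r a (Z (a + ι (N r)) μ) 0
      ≈⟨ +-cong (trans (congruent (Π-linear r (a + 1#)) (Z-τ a μ) 0) (Π-τ r a (Z (a - 1#) μ) 0))
                (*-congˡ (Π-last r a μ 0)) ⟨
    Π (suc r) a (τ μ) 0 + 1# * Π (suc r) a μ 0
      ≈⟨ linear (Π-linear (suc r) a) (τ μ) 1# μ 0 ⟨
    Π (suc r) a (τ μ ⊕ 1# ⊙ μ) 0            ≈⟨ congruent (Π-linear (suc r) a) μ-rec 0 ⟩
    Π (suc r) a (2# ⊙ pow y) 0              ≈⟨ scaling (Π-linear (suc r) a) 2# (pow y) 0 ⟩
    2# * Π (suc r) a (pow y) 0              ∎)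
    where
    open SetoidReasoning setoid
    -- The factors not shared are X - (a - 1) in f(X + 1) and X - (a + r) in f(X).
    average : Z (a - 1#) μ ⊕ 1# ⊙ Z (a + ι (N r)) μ ≋ 2# ⊙ Z z μ
    average n = trans
      (solve 4 (λ p q f₁ f₀ → (f₁ :+ (:- p) :* f₀) :+ :1 :* (f₁ :+ (:- q) :* f₀)
          := (f₁ :+ f₁) :+ (:- (p :+ q)) :* f₀) refl (a - 1#) (a + ι (N r)) (μ (suc n)) (μ n))
      (trans (+-congˡ (*-congʳ (-‿cong a≈z)))
        (solve 3 (λ z f₁ f₀ → (f₁ :+ f₁) :+ (:- (z :+ z)) :* f₀ := (:1 :+ :1) :* (f₁ :+ (:- z) :* f₀))
          refl z (μ (suc n)) (μ n)))

  Z-pair : ∀ {p q z} d → p ≈ z + ι d → q ≈ z - ι d → ∀ f → Z p (Z q f) ≋ Quad z (sq d) f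
  Z-pair {p} {q} {z} d p≈ q≈ f n = trans (Z-cong p≈ (Z q f) n) (trans (congruent (Z-linear (z + ι d)) (Z-cong q≈ f) n)
    (trans (solve 5 (λ z d f₀ f₁ f₂ →
        (f₂ :+ (:- (z :- d)) :* f₁) :+ (:- (z :+ d)) :* (f₁ :+ (:- (z :- d)) :* f₀)
        := ((f₂ :+ (:- z) :* f₁) :+ (:- z) :* (f₁ :+ (:- z) :* f₀)) :+ (:- (d :* d)) :* f₀)
        refl z (ι d) (f n) (f (suc n)) (f (suc (suc n))))
      (+-congˡ (*-congʳ (-‿cong (sym (ι.*-homo d d)))))))

  -- Peels off the outermost pair of roots z - d and z + d; the inner roots keep their midpoint.
  Π-suc-suc : ∀ r {b z} d → b + 1# + ι (N r) ≈ z + ι d → b ≈ z - ι d →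
    ∀ f → Π (suc (suc r)) b f ≋ Π r (b + 1#) (Quad z (sq d) f)
  Π-suc-suc r {b} d p≈ q≈ f n = trans (Π-last r (b + 1#) (Z b f) n)
    (congruent (Π-linear r (b + 1#)) (Z-pair d p≈ q≈ f) n)

  private
    ι-shift : ∀ k d → ι (N k ℚ.+ d) ≈ ι (N k) + ι d
    ι-shift k d = ι.+-homo _ _

  -- The 2k consecutive roots starting at a have midpoint a + k - 1/2, which the hypothesis places
  -- at z; in `Π-odd` the middle root a + k is z itself.
  Π-even : ∀ k {a z} → a + ι (N k) ≈ z + ι ½ → ∀ f → Π (k ℕ.* 2) a f ≋ C z ½ k f
  Π-even zero a≈ f n = refl
  Π-even (suc k) {a} {z} a≈ f n = trans
    (Π-suc-suc (k ℕ.* 2) (N k ℚ.+ ½)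
      (trans (+-congˡ (ιN-double k))
        (trans (solve 2 (λ a k → a :+ :1 :+ (k :+ k) := (a :+ (:1 :+ k)) :+ k) refl a (ι (N k)))
        (trans (+-congʳ a+≈) (trans (solve 3 (λ z h k → (z :+ h) :+ k := z :+ (k :+ h)) refl z (ι ½) (ι (N k)))
                                    (+-congˡ (sym (ι-shift k ½)))))))
      (trans (solve 2 (λ a k → a := (a :+ (:1 :+ k)) :- (:1 :+ k)) refl a (ι (N k)))
        (trans (+-congʳ a+≈) (trans (solve 2 (λ z k → (z :+ :½) :- (:1 :+ k) := z :- (k :+ :½)) refl z (ι (N k)))
                                    (+-congˡ (-‿cong (sym (ι-shift k ½)))))))
      f n)
    (Π-even k (trans (+-assoc _ _ _) a+≈) (Quad z (sq (N k ℚ.+ ½)) f) n)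
    where
    a+≈ : a + (1# + ι (N k)) ≈ z + ι ½
    a+≈ = trans (+-congˡ (sym (ιN-suc k))) a≈

  Π-odd : ∀ k {a z} → a + ι (N k) ≈ z → ∀ f → Π (suc (k ℕ.* 2)) a f ≋ C z 1ℚ k (Z z f)
  Π-odd zero a≈ f n = Z-cong (trans (sym (trans (+-congˡ ι.0#-homo) (+-identityʳ _))) a≈) f n
  Π-odd (suc k) {a} {z} a≈ f n = trans
    (Π-suc-suc (suc (k ℕ.* 2)) (N k ℚ.+ 1ℚ)
      (trans (+-congˡ (trans (ιN-suc (k ℕ.* 2)) (+-congˡ (ιN-double k))))
        (trans (solve 2 (λ a k → a :+ :1 :+ (:1 :+ (k :+ k)) := (a :+ (:1 :+ k)) :+ (k :+ :1)) refl a (ι (N k)))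
        (+-cong a+≈ k+1)))
      (trans (solve 2 (λ a k → a := (a :+ (:1 :+ k)) :- (k :+ :1)) refl a (ι (N k)))
        (+-cong a+≈ (-‿cong k+1)))
      f n)
    (trans (Π-odd k (trans (+-assoc _ _ _) a+≈) (Quad z (sq (N k ℚ.+ 1ℚ)) f) n)
      (congruent (C-linear z 1ℚ k) (linear (Z-linear z) (Z z (Z z f)) (- sq (N k ℚ.+ 1ℚ)) f) n))
    where
    a+≈ : a + (1# + ι (N k)) ≈ z
    a+≈ = trans (+-congˡ (sym (ιN-suc k))) a≈
    k+1 : ι (N k) + 1# ≈ ι (N k ℚ.+ 1ℚ)
    k+1 = sym (trans (ι-shift k 1ℚ) (+-congˡ ι.1#-homo))

  -- `pow y` is evaluation at y, so multiplication by a polynomial acts on it as a scalar; `C-pow`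
  -- iterates this.
  Z-pow : ∀ a y → Z a (pow y) ≋ (y - a) ⊙ pow y
  Z-pow a y n = solve 3 (λ y a p → y :* p :+ (:- a) :* p := (y :- a) :* p) refl y a (y ^ n)

  C-pow : ∀ {z y w} → y - z ≈ ι w → ∀ ρ k → C z ρ k (pow y) ≋ ι (Φ (w ℚ.* w) ρ k) ⊙ pow y
  C-pow y-z≈w ρ zero n = sym (trans (*-congʳ ι.1#-homo) (*-identityˡ _))
  C-pow {z} {y} {w} y-z≈w ρ (suc k) n = begin
    C z ρ k (Quad z (sq q) (pow y)) n          ≈⟨ congruent (C-linear z ρ k) quad-pow n ⟩
    C z ρ k (ι (w ℚ.* w ℚ.- q ℚ.* q) ⊙ pow y) n ≈⟨ scaling (C-linear z ρ k) _ (pow y) n ⟩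
    ι (w ℚ.* w ℚ.- q ℚ.* q) * C z ρ k (pow y) n ≈⟨ *-congˡ (C-pow y-z≈w ρ k n) ⟩
    ι (w ℚ.* w ℚ.- q ℚ.* q) * (ι φ * pow y n)   ≈⟨ *-assoc _ _ _ ⟨
    ι (w ℚ.* w ℚ.- q ℚ.* q) * ι φ * pow y n     ≈⟨ *-congʳ (trans (*-comm _ _) (sym (ι.*-homo _ _))) ⟩
    ι (φ ℚ.* (w ℚ.* w ℚ.- q ℚ.* q)) * pow y n   ∎
    where
    open SetoidReasoning setoid
    q = N k ℚ.+ ρ
    φ = Φ (w ℚ.* w) ρ k
    quad-pow : Quad z (sq q) (pow y) ≋ ι (w ℚ.* w ℚ.- q ℚ.* q) ⊙ pow y
    quad-pow m = trans
      (solve 4 (λ y z s p → (((y :* (y :* p)) :+ (:- z) :* (y :* p)) :+ (:- z) :* (y :* p :+ (:- z) :* p)) :+ (:- s) :* p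
          := ((y :- z) :* (y :- z) :- s) :* p) refl y z (sq q) (y ^ m))
      (*-congʳ (sym (trans (ι.+-homo _ _) (+-cong (trans (ι.*-homo w w) (sym (*-cong y-z≈w y-z≈w))) (ι.-‿homo _)))))

  -- C⁰ has the factor (X - z)², which splits off.
  C-zero-suc : ∀ z k f → C z 0ℚ (suc k) f ≋ C z 1ℚ k (Z z (Z z f))
  C-zero-suc z zero f n = trans (+-congˡ (trans (*-congʳ (-‿cong ι.0#-homo))
    (solve 1 (λ f → (:- :0) :* f := :0) refl (f n)))) (+-identityʳ _)
  C-zero-suc z (suc k) f n = trans (C-zero-suc z k (Quad z s f) n) (congruent (C-linear z 1ℚ k) (λ m →
    trans (congruent (Z-linear z) (linear (Z-linear z) (Z z (Z z f)) (- s) f) m)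
      (trans (linear (Z-linear z) (Z z (Z z (Z z f))) (- s) (Z z f) m)
        (+-congˡ (*-congʳ (-‿cong (ι.⟦⟧-cong (≡.cong (λ q → q ℚ.* q) s≡))))))) n)
    where
    s = sq (N (suc k) ℚ.+ 0ℚ)
    s≡ : N (suc k) ℚ.+ 0ℚ ≡ N k ℚ.+ 1ℚ
    s≡ = ≡.trans (ℚ.+-identityʳ (N (suc k))) (≡.trans (N-suc k) (ℚ.+-comm 1ℚ (N k)))

  module _ {y z : Carrier} {w : ℚ} (y≈ : y - (z + ι ½) ≈ ι w) where

    -- Here f has 2k + 1 factors centred at z + 1/2, and the middle one takes the value w at y; the
    -- result is odd in w.
    Euler-C½ : ∀ k → C z ½ k (Z z (𝓔 y)) 0 ≈ ι (w ℚ.* Φ (w ℚ.* w) 1ℚ k)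
    Euler-C½ k = begin
      C z ½ k (Z z (𝓔 y)) 0                ≈⟨ Π-even k a≈ (Z z (𝓔 y)) 0 ⟨
      Π (k ℕ.* 2) a (Z z (𝓔 y)) 0          ≈⟨ Euler-Π (Euler-recurrence y) (k ℕ.* 2) center ⟩
      Π (suc (k ℕ.* 2)) a (pow y) 0        ≈⟨ Π-odd k a≈ (pow y) 0 ⟩
      C z′ 1ℚ k (Z z′ (pow y)) 0           ≈⟨ congruent (C-linear z′ 1ℚ k) (Z-pow z′ y) 0 ⟩
      C z′ 1ℚ k ((y - z′) ⊙ pow y) 0       ≈⟨ scaling (C-linear z′ 1ℚ k) _ (pow y) 0 ⟩
      (y - z′) * C z′ 1ℚ k (pow y) 0       ≈⟨ *-cong y≈ (trans (C-pow y≈ 1ℚ k 0) (*-identityʳ _)) ⟩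
      ι w * ι (Φ (w ℚ.* w) 1ℚ k)           ≈⟨ ι.*-homo _ _ ⟨
      ι (w ℚ.* Φ (w ℚ.* w) 1ℚ k)           ∎
      where
      open SetoidReasoning setoid
      z′ = z + ι ½
      a  = z′ - ι (N k)
      a≈ : a + ι (N k) ≈ z′
      a≈ = solve 2 (λ z k → z :- k :+ k := z) refl z′ (ι (N k))
      center : (a - 1#) + (a + ι (N (k ℕ.* 2))) ≈ z + z
      center = trans (+-congˡ (+-congˡ (ιN-double k)))
        (solve 2 (λ z k → let a = (z :+ :½) :- k in (a :- :1) :+ (a :+ (k :+ k)) := z :+ z) refl z (ι (N k)))

    -- Here f has 2k + 2 factors, so the result is even in w. The 2k + 1 shared roots include z,
    -- which supplies one of the two factors X - z.
    Euler-C¹ : ∀ k → C z 1ℚ k (Z z (Z z (𝓔 y))) 0 ≈ ι (Φ (w ℚ.* w) ½ (suc k))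
    Euler-C¹ k = begin
      C z 1ℚ k (Z z (Z z (𝓔 y))) 0         ≈⟨ Π-odd k a≈ (Z z (𝓔 y)) 0 ⟨
      Π (suc (k ℕ.* 2)) a (Z z (𝓔 y)) 0    ≈⟨ Euler-Π (Euler-recurrence y) (suc (k ℕ.* 2)) center ⟩
      Π (suc k ℕ.* 2) a (pow y) 0          ≈⟨ Π-even (suc k) a≈′ (pow y) 0 ⟩
      C z′ ½ (suc k) (pow y) 0             ≈⟨ trans (C-pow y≈ ½ (suc k) 0) (*-identityʳ _) ⟩
      ι (Φ (w ℚ.* w) ½ (suc k))            ∎
      where
      open SetoidReasoning setoid
      z′ = z + ι ½
      a  = z - ι (N k)
      a≈ : a + ι (N k) ≈ z
      a≈ = solve 2 (λ z k → z :- k :+ k := z) refl z (ι (N k))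
      a≈′ : a + ι (N (suc k)) ≈ z′ + ι ½
      a≈′ = trans (+-congˡ (ιN-suc k))
        (solve 2 (λ z k → z :- k :+ (:1 :+ k) := (z :+ :½) :+ :½) refl z (ι (N k)))
      center : (a - 1#) + (a + ι (N (suc (k ℕ.* 2)))) ≈ z + z
      center = trans (+-congˡ (+-congˡ (trans (ιN-suc (k ℕ.* 2)) (+-congˡ (ιN-double k)))))
        (solve 2 (λ z k → let a = z :- k in (a :- :1) :+ (a :+ (:1 :+ (k :+ k))) := z :+ z) refl z (ι (N k)))

    Euler-C⁰ : ∀ k → C z 0ℚ k (𝓔 y) 0 ≈ ι (Φ (w ℚ.* w) ½ k)
    -- No factor (X - z)² splits off for k = 0; the value is E_0 = 1, by the recurrence in degree 0.
    Euler-C⁰ zero = trans (½-cancel (trans (solve 1 (λ e → (:1 :+ :1) :* e := e :+ :1 :* e) refl (𝓔 y 0))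
      (Euler-recurrence y 0))) (sym ι.1#-homo)
    Euler-C⁰ (suc k) = trans (C-zero-suc z k (𝓔 y) 0) (Euler-C¹ k)

-- The squared norm of the m-th monic orthogonal polynomial.
norms : (v α h : ℚ) → ℕ → ℚ
norms v α h m = h ℚ.* ∏< (γ ∘ suc) m
  where open Recurrence v α

-- Hankel determinants from values on central factorials

module HankelDeterminants {c ℓ} (A : ℚAlgebra c ℓ) where
  open ℚAlgebra A
  open AlgebraSolver A
  open SequenceModule A
  open ColumnExpansion A
  open Operators A
  open Determinant commutativeRing using (H)

  LeadingEntry : ℕ → ℚ → Series → Set ℓ
  LeadingEntry n h f = (∀ i → i < n → f i ≈ 0#) × f n ≈ ι h

  module _ (z : Carrier) (v α h : ℚ) (f : Series) where
    open Polynomials z v α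

    -- Below row 2k, even powers of X - z vanish by orthogonality and odd ones by parity.
    leading-even : (∀ k → C z α k f 0 ≈ ι (h ℚ.* Φ v (α ℚ.+ ½) k)) → EvenVanishing (Z z f) →
      ∀ k → LeadingEntry (k ℕ.* 2) (norms v α h k) (P k f)
    leading-even f-value Zf-vanishes k =
      let low , lead = leading-moment z (k ℕ.* 2) (P k f) zeros
      in low , trans lead (norm f h f-value k)
      where
      zeros : ∀ l → l < k ℕ.* 2 → Zpow z l (P k f) 0 ≈ 0#
      zeros = parity (λ l → l < k ℕ.* 2 → Zpow z l (P k f) 0 ≈ 0#)
        (λ i i<k → orthogonal f h f-value i k (ℕ.*-cancelʳ-< 2 i k i<k))
        (λ i _ → trans (congruent (Zpow-linear z (i ℕ.* 2)) (Z-P k f) 0) (P-vanishing Zf-vanishes k i))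

    -- Even powers of X - z vanish by parity. For odd powers one factor X - z is moved into the
    -- functional, and orthogonality is applied to `Z z f`.
    leading-odd : EvenVanishing f → (∀ k → C z α k (Z z f) 0 ≈ ι (h ℚ.* Φ v (α ℚ.+ ½) k)) →
      ∀ k → LeadingEntry (suc (k ℕ.* 2)) (norms v α h k) (P k f)
    leading-odd f-vanishes Zf-value k =
      let low , lead = leading-moment z (suc (k ℕ.* 2)) (P k f) zeros
      in low , trans lead (trans (congruent (Zpow-linear z (k ℕ.* 2)) (Z-P k f) 0) (norm (Z z f) h Zf-value k))
      where
      zeros : ∀ l → l < suc (k ℕ.* 2) → Zpow z l (P k f) 0 ≈ 0#
      zeros = parity (λ l → l < suc (k ℕ.* 2) → Zpow z l (P k f) 0 ≈ 0#)
        (λ i _ → P-vanishing f-vanishes k i)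
        (λ i i<k → trans (congruent (Zpow-linear z (i ℕ.* 2)) (Z-P k f) 0)
                     (orthogonal (Z z f) h Zf-value i k (ℕ.*-cancelʳ-< 2 i k (ℕ.≤-pred i<k))))

  module _ (z : Carrier) (v α₀ α₁ : ℚ) (μ : Series) where
    private
      module P₀ = Polynomials z v α₀
      module P₁ = Polynomials z v α₁

    columns : ℕ → Series
    columns = parity (λ _ → Series) (λ k → P₀.P k μ) (λ k → P₁.P k (Z z μ))

    columns-even : ∀ k → columns (k ℕ.* 2) ≡ P₀.P k μ
    columns-even = parity-even (λ _ → Series) (λ k → P₀.P k μ) (λ k → P₁.P k (Z z μ))

    columns-odd : ∀ k → columns (suc (k ℕ.* 2)) ≡ P₁.P k (Z z μ)
    columns-odd = parity-odd (λ _ → Series) (λ k → P₀.P k μ) (λ k → P₁.P k (Z z μ))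

    columns-monic : ∀ n → Monic (powers μ) n (columns n)
    columns-monic = parity (λ n → Monic (powers μ) n (columns n))
      (λ k → ≡.subst₂ (Monic (powers μ)) (ℕ.+-identityʳ (k ℕ.* 2)) (≡.sym (columns-even k))
               (P₀.P-monic (powers μ) shift-powers 0 μ-monic k))
      (λ k → ≡.subst₂ (Monic (powers μ)) (ℕ.+-comm (k ℕ.* 2) 1) (≡.sym (columns-odd k))
               (P₁.P-monic (powers μ) shift-powers 1 (P₀.Z-monic (powers μ) shift-powers 0 μ-monic) k))
      where
      shift-powers : ∀ n → shift (powers μ n) ≋ powers μ (suc n)
      shift-powers n i = reflexive (≡.cong μ (≡.sym (ℕ.+-suc i n)))
      μ-monic : Monic (powers μ) 0 μ
      μ-monic = monic-cong (powers μ) 0 (λ i → reflexive (≡.cong μ (ℕ.+-identityʳ i))) (monic-zero (powers μ))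

  -- A column (X - z) P_k is tested against odd powers of X - z, so the odd columns are orthogonal
  -- with respect to (X - z)² μ rather than μ. This is why the two families differ in α and in the
  -- initial value.
  even-hankel : ∀ z v h₀ h₁ μ →
    (∀ k → C z 0ℚ k μ 0 ≈ ι (h₀ ℚ.* Φ v (0ℚ ℚ.+ ½) k)) →
    (∀ k → C z ½ k (Z z μ) 0 ≈ 0#) →
    (∀ k → C z 1ℚ k (Z z (Z z μ)) 0 ≈ ι (h₁ ℚ.* Φ v (1ℚ ℚ.+ ½) k)) →
    ∀ n → H n μ ≈ ι (∏< (parity (λ _ → ℚ) (norms v 0ℚ h₀) (norms v 1ℚ h₁)) (suc n))
  even-hankel z v h₀ h₁ μ μ-value Zμ≈0 Z²μ-value n = trans
    (H-monic μ p (columns-monic z v 0ℚ 1ℚ μ) n)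
    (triangular (suc n) p h (λ j → proj₁ (leading j)) (λ j → proj₂ (leading j)))
    where
    p = columns z v 0ℚ 1ℚ μ
    h = parity (λ _ → ℚ) (norms v 0ℚ h₀) (norms v 1ℚ h₁)
    Zμ-vanishes = C-vanishing z ½ {Z z μ} Zμ≈0
    leading : ∀ j → LeadingEntry j (h j) (p j)
    leading = parity (λ j → LeadingEntry j (h j) (p j))
      (λ k → ≡.subst₂ (LeadingEntry (k ℕ.* 2))
               (≡.sym (parity-even (λ _ → ℚ) (norms v 0ℚ h₀) (norms v 1ℚ h₁) k))
               (≡.sym (columns-even z v 0ℚ 1ℚ μ k))
               (leading-even z v 0ℚ h₀ μ μ-value Zμ-vanishes k))
      (λ k → ≡.subst₂ (LeadingEntry (suc (k ℕ.* 2)))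
               (≡.sym (parity-odd (λ _ → ℚ) (norms v 0ℚ h₀) (norms v 1ℚ h₁) k))
               (≡.sym (columns-odd z v 0ℚ 1ℚ μ k))
               (leading-odd z v 1ℚ h₁ (Z z μ) Zμ-vanishes Z²μ-value k))

  -- Both kinds of columns are governed by (X - z) μ, so one family P_k serves both: `P k μ`
  -- vanishes before row 2k + 1 and its multiple by X - z before row 2k, with the same norm there.
  odd-hankel : ∀ z v h μ →
    (∀ k → C z 0ℚ k μ 0 ≈ 0#) →
    (∀ k → C z ½ k (Z z μ) 0 ≈ ι (h ℚ.* Φ v (½ ℚ.+ ½) k)) →
    (∀ k → C z 1ℚ k (Z z (Z z μ)) 0 ≈ 0#) →
    ∀ n → H (n ℕ.* 2) μ ≈ 0#
        × H (suc (n ℕ.* 2)) μ ≈ ι (∏< (λ k → ℚ.- (norms v ½ h k ℚ.* norms v ½ h k)) (suc n))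
  odd-hankel z v h μ μ≈0 Zμ-value Z²μ≈0 n =
    trans (H-monic μ p p-monic (n ℕ.* 2)) (blocks-odd blocks n) ,
    trans (H-monic μ p p-monic (suc (n ℕ.* 2))) (blocks-even blocks (suc n))
    where
    p = columns z v ½ ½ μ
    p-monic = columns-monic z v ½ ½ μ
    even : ∀ k → LeadingEntry (suc (k ℕ.* 2)) (norms v ½ h k) (p (k ℕ.* 2))
    even k = ≡.subst (LeadingEntry (suc (k ℕ.* 2)) (norms v ½ h k)) (≡.sym (columns-even z v ½ ½ μ k))
      (leading-odd z v ½ h μ (C-vanishing z 0ℚ {μ} μ≈0) Zμ-value k)
    odd : ∀ k → LeadingEntry (k ℕ.* 2) (norms v ½ h k) (p (suc (k ℕ.* 2)))
    odd k = ≡.subst (LeadingEntry (k ℕ.* 2) (norms v ½ h k)) (≡.sym (columns-odd z v ½ ½ μ k))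
      (leading-even z v ½ h (Z z μ) Zμ-value (C-vanishing z 1ℚ {Z z (Z z μ)} Z²μ≈0) k)
    blocks : AntidiagonalBlocks p (norms v ½ h)
    blocks = record
      { even-zero = λ k → proj₁ (even k) ; even-value = λ k → proj₂ (even k)
      ; odd-zero  = λ k → proj₁ (odd k)  ; odd-value  = λ k → proj₂ (odd k) }

∏<-cong : ∀ {g h : ℕ → ℚ} → (∀ k → g k ≡ h k) → ∀ n → ∏< g n ≡ ∏< h n
∏<-cong g≡h zero    = ≡.refl
∏<-cong g≡h (suc n) = ≡.cong₂ ℚ._*_ (∏<-cong g≡h n) (g≡h n)

-- Brings the values of `Euler-C¹` into the form with base point α + 1/2 for α = 1.
Φ-first : ∀ v k → Φ v ½ (suc k) ≡ (v ℚ.- ½ ℚ.* ½) ℚ.* Φ v (1ℚ ℚ.+ ½) k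
Φ-first v k = ≡.trans (∏<-first (λ i → v ℚ.- (N i ℚ.+ ½) ℚ.* (N i ℚ.+ ½)) k)
  (≡.cong ((v ℚ.- ½ ℚ.* ½) ℚ.*_) (∏<-cong (λ i → ≡.cong (λ a → v ℚ.- a ℚ.* a) (N-suc-½ i)) k))
  where
  N-suc-½ : ∀ i → N (suc i) ℚ.+ ½ ≡ N i ℚ.+ (1ℚ ℚ.+ ½)
  N-suc-½ i = ≡.trans (≡.cong (ℚ._+ ½) (≡.trans (N-suc i) (ℚ.+-comm 1ℚ (N i)))) (ℚ.+-assoc (N i) 1ℚ ½)

private module Rational where
  open ℚ.+-*-Solver

  -p*-p≡p*p : ∀ p → ℚ.- p ℚ.* ℚ.- p ≡ p ℚ.* p
  -p*-p≡p*p = solve 1 (λ p → :- p :* :- p := p :* p) ≡.refl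

  p+p≡2p : ∀ p → p ℚ.+ p ≡ (1ℚ ℚ.+ 1ℚ) ℚ.* p
  p+p≡2p = solve 1 (λ p → p :+ p := (con 1ℚ :+ con 1ℚ) :* p) ≡.refl

  -pq+pq≡0 : ∀ p q → ℚ.- p ℚ.* q ℚ.+ p ℚ.* q ≡ 0ℚ
  -pq+pq≡0 = solve 2 (λ p q → :- p :* q :+ p :* q := con 0ℚ) ≡.refl

  halves : ∀ p q → ℚ.- (½ ℚ.* p) ℚ.* q ℚ.+ ℚ.- (½ ℚ.* p ℚ.* q) ≡ ℚ.- p ℚ.* q
  halves = solve 2 (λ p q → :- (con ½ :* p) :* q :+ :- (con ½ :* p :* q) := :- p :* q) ≡.refl

open Rational

-- Sums and differences of Euler polynomials

module EulerHankel {c ℓ} (A : ℚAlgebra c ℓ) where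
  open ℚAlgebra A
  open AlgebraSolver A
  open SequenceModule A
  open Operators A
  open HankelDeterminants A
  open EulerFunctional A
  open CentralFactorials A
  open Determinant commutativeRing using (H)

  module _ {y₁ y₂ : Carrier} {u : ℚ} (y₂-y₁≈u : y₂ - y₁ ≈ ι u) where

    private
      w v : ℚ
      w = ½ ℚ.* u
      v = w ℚ.* w

      z : Carrier
      z = ι ½ * (y₁ + y₂) - ι ½

      ιw≈ : ι w ≈ ι ½ * (y₂ - y₁)
      ιw≈ = trans (ι.*-homo ½ u) (*-congˡ (sym y₂-y₁≈u))

      y₂≈ : y₂ - (z + ι ½) ≈ ι w
      y₂≈ = trans (solve 2 (λ a b → b :- ((:½ :* (a :+ b) :- :½) :+ :½) := :½ :* (b :- a)) refl y₁ y₂) (sym ιw≈)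

      y₁≈ : y₁ - (z + ι ½) ≈ ι (ℚ.- w)
      y₁≈ = trans (solve 2 (λ a b → a :- ((:½ :* (a :+ b) :- :½) :+ :½) := :- (:½ :* (b :- a))) refl y₁ y₂)
        (trans (-‿cong (sym ιw≈)) (sym (ι.-‿homo w)))

      v≡ : ℚ.- w ℚ.* ℚ.- w ≡ v
      v≡ = -p*-p≡p*p w

      f₁ f₂ : Series
      f₁ = 𝓔 y₁
      f₂ = 𝓔 y₂

      linear-+ : ∀ {T} → Linear T → T (λ k → f₁ k + f₂ k) ≋ λ k → T f₁ k + T f₂ k
      linear-+ T-lin n = trans (congruent T-lin (λ m → +-congˡ (sym (*-identityˡ (f₂ m)))) n)
        (trans (linear T-lin f₁ 1# f₂ n) (+-congˡ (*-identityˡ _)))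

      linear-- : ∀ {T} → Linear T → T (λ k → f₁ k - f₂ k) ≋ λ k → T f₁ k - T f₂ k
      linear-- T-lin n = trans
        (congruent T-lin (λ m → solve 2 (λ a b → a :- b := a :+ (:- :1) :* b) refl (f₁ m) (f₂ m)) n)
        (trans (linear T-lin f₁ (- 1#) f₂ n) (solve 2 (λ a b → a :+ (:- :1) :* b := a :- b) refl _ _))

      T⁰ T½ T¹ : ℕ → Series → Series
      T⁰ k f = C z 0ℚ k f
      T½ k f = C z ½ k (Z z f)
      T¹ k f = C z 1ℚ k (Z z (Z z f))

      T⁰-linear : ∀ k → Linear (T⁰ k)
      T⁰-linear k = C-linear z 0ℚ k

      T½-linear : ∀ k → Linear (T½ k)
      T½-linear k = ∘-linear (C-linear z ½ k) (Z-linear z)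

      T¹-linear : ∀ k → Linear (T¹ k)
      T¹-linear k = ∘-linear (C-linear z 1ℚ k) (∘-linear (Z-linear z) (Z-linear z))

      T⁰f₁ : ∀ k → T⁰ k f₁ 0 ≈ ι (Φ v ½ k)
      T⁰f₁ k = trans (Euler-C⁰ y₁≈ k) (ι.⟦⟧-cong (≡.cong (λ v → Φ v ½ k) v≡))

      T¹f₁ : ∀ k → T¹ k f₁ 0 ≈ ι (Φ v ½ (suc k))
      T¹f₁ k = trans (Euler-C¹ y₁≈ k) (ι.⟦⟧-cong (≡.cong (λ v → Φ v ½ (suc k)) v≡))

      T½f₁ : ∀ k → T½ k f₁ 0 ≈ ι (ℚ.- w ℚ.* Φ v 1ℚ k)
      T½f₁ k = trans (Euler-C½ y₁≈ k) (ι.⟦⟧-cong (≡.cong (λ v → ℚ.- w ℚ.* Φ v 1ℚ k) v≡))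

      double : ∀ p → ι p + ι p ≈ ι ((1ℚ ℚ.+ 1ℚ) ℚ.* p)
      double p = trans (sym (ι.+-homo p p)) (ι.⟦⟧-cong (p+p≡2p p))

    -- Values even in w double and odd ones cancel. The initial values are 2 for μ and, by
    -- `Φ-first`, 2 (v - 1/4) for (X - z)² μ.
    Euler-sum-hankel : ∀ n → H n (λ k → 𝓔 y₁ k + 𝓔 y₂ k)
      ≈ ι (∏< (parity (λ _ → ℚ) (norms v 0ℚ (1ℚ ℚ.+ 1ℚ)) (norms v 1ℚ ((1ℚ ℚ.+ 1ℚ) ℚ.* (v ℚ.- ½ ℚ.* ½)))) (suc n))
    Euler-sum-hankel = even-hankel z v (1ℚ ℚ.+ 1ℚ) ((1ℚ ℚ.+ 1ℚ) ℚ.* (v ℚ.- ½ ℚ.* ½)) _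
      (λ k → trans (linear-+ (T⁰-linear k) 0) (trans (+-cong (T⁰f₁ k) (Euler-C⁰ y₂≈ k)) (double (Φ v ½ k))))
      (λ k → trans (linear-+ (T½-linear k) 0) (trans (+-cong (T½f₁ k) (Euler-C½ y₂≈ k))
        (trans (sym (ι.+-homo _ _)) (trans (ι.⟦⟧-cong (-pq+pq≡0 w (Φ v 1ℚ k))) ι.0#-homo))))
      (λ k → trans (linear-+ (T¹-linear k) 0) (trans (+-cong (T¹f₁ k) (Euler-C¹ y₂≈ k))
        (trans (double (Φ v ½ (suc k))) (ι.⟦⟧-cong (≡.trans (≡.cong ((1ℚ ℚ.+ 1ℚ) ℚ.*_) (Φ-first v k))
          (≡.sym (ℚ.*-assoc (1ℚ ℚ.+ 1ℚ) (v ℚ.- ½ ℚ.* ½) (Φ v (1ℚ ℚ.+ ½) k))))))))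

    -- Only values odd in w survive. Since y₁ has -w where y₂ has w, the initial value is -w - w =
    -- -u.
    Euler-difference-hankel : ∀ n → H (n ℕ.* 2) (λ k → 𝓔 y₁ k - 𝓔 y₂ k) ≈ 0#
      × H (suc (n ℕ.* 2)) (λ k → 𝓔 y₁ k - 𝓔 y₂ k)
          ≈ ι (∏< (λ k → ℚ.- (norms v ½ (ℚ.- u) k ℚ.* norms v ½ (ℚ.- u) k)) (suc n))
    Euler-difference-hankel = odd-hankel z v (ℚ.- u) _
      (λ k → trans (linear-- (T⁰-linear k) 0) (trans (+-cong (T⁰f₁ k) (-‿cong (Euler-C⁰ y₂≈ k))) (-‿inverseʳ _)))
      (λ k → trans (linear-- (T½-linear k) 0) (trans (+-cong (T½f₁ k) (-‿cong (Euler-C½ y₂≈ k)))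
        (trans (+-congˡ (sym (ι.-‿homo _))) (trans (sym (ι.+-homo _ _)) (ι.⟦⟧-cong (halves u (Φ v 1ℚ k)))))))
      (λ k → trans (linear-- (T¹-linear k) 0) (trans (+-cong (T¹f₁ k) (-‿cong (Euler-C¹ y₂≈ k))) (-‿inverseʳ _)))

  module _ (q : ℕ) .{{_ : NonZero q}} (r s : ℕ) (x : Carrier) where
    open Euler A using (arg)

    arg-difference : arg q r s x s - arg q r s x r ≈ ι ((+ s ℤ.- + r) / q)
    arg-difference = begin
      ι (+ 1 / q) * (x + ι (N s)) - ι (+ 1 / q) * (x + ι (N r))
        ≈⟨ solve 4 (λ p x s r → p :* (x :+ s) :- p :* (x :+ r) := (s :- r) :* p) refl
             (ι (+ 1 / q)) x (ι (N s)) (ι (N r)) ⟩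
      (ι (N s) - ι (N r)) * ι (+ 1 / q)       ≈⟨ *-congʳ (trans (ι.+-homo _ _) (+-congˡ (ι.-‿homo _))) ⟨
      ι (N s ℚ.- N r) * ι (+ 1 / q)           ≈⟨ ι.*-homo _ _ ⟨
      ι ((N s ℚ.- N r) ℚ.* (+ 1 / q))
        ≡⟨ ≡.cong (λ a → ι (a ℚ.* (+ 1 / q))) (≡.trans (/-+ (+ s) (ℤ.- + r)) (≡.cong (N s ℚ.+_) (/-neg r))) ⟨
      ι ((+ s ℤ.- + r) / 1 ℚ.* (+ 1 / q))     ≡⟨ ≡.cong ι (/-N (+ s ℤ.- + r) q) ⟨
      ι ((+ s ℤ.- + r) / q)                   ∎
      where
      open SetoidReasoning setoid
      /-neg : ∀ r → (ℤ.- + r) / 1 ≡ ℚ.- N r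
      /-neg zero    = ≡.refl
      /-neg (suc r) = ≡.refl

-- Closed forms for the products of norms

open import Data.Rational.Base using (_*_; _-_; -_; +-*-rawSemiring)
open import Algebra.Definitions.RawSemiring +-*-rawSemiring using (_^_; product)

∏<-cong-< : ∀ {g h : ℕ → ℚ} n → (∀ i → i < n → g i ≡ h i) → ∏< g n ≡ ∏< h n
∏<-cong-< zero    g≡h = ≡.refl
∏<-cong-< (suc n) g≡h =
  ≡.cong₂ _*_ (∏<-cong-< n (λ i i<n → g≡h i (ℕ.m≤n⇒m≤1+n i<n))) (g≡h n ℕ.≤-refl)

∏≡∏< : ∀ a b f → ∏ a b f ≡ ∏< (λ i → f (a ℕ.+ i)) (suc b ∸ a)
∏≡∏< a b f = product≡∏< (λ i → f (a ℕ.+ i)) (suc b ∸ a)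
  where
  product≡∏< : ∀ g n → product {n} (g ∘ toℕ) ≡ ∏< g n
  product≡∏< g zero    = ≡.refl
  product≡∏< g (suc n) = ≡.trans (≡.cong (g 0 *_) (product≡∏< (g ∘ suc) n)) (≡.sym (∏<-first g n))

N-^2 : ∀ l → N (l ℕ.^ 2) ≡ N l * N l
N-^2 l = ≡.trans (N-* l (l ℕ.* 1)) (≡.cong (λ k → N l * N k) (ℕ.*-identityʳ l))

module ProductFormulas (u : ℚ) where
  open ℚ.+-*-Solver
  open ≡.≡-Reasoning

  v : ℚ
  v = (½ * u) * (½ * u)

  γ⁰ γ½ γ¹ : ℕ → ℚ
  γ⁰ = Recurrence.γ v 0ℚ
  γ½ = Recurrence.γ v ½
  γ¹ = Recurrence.γ v 1ℚ

  g⁻ g⁺ d : ℕ → ℚ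
  g⁻ l = (+ (l ℕ.^ 2) / 4) * (u ^ 2 - (+ (2 ℕ.* l) / 1) ^ 2)
  g⁺ l = (+ (l ℕ.^ 2) / 4) * (u ^ 2 - (+ (2 ℕ.* l) / 1 - 1ℚ) ^ 2)
  d  l = u ^ 2 - (+ (2 ℕ.* l ℕ.+ 1) / 1) ^ 2

  private
    ¼ : ℚ
    ¼ = + 1 / 4

    2ℚ : ℚ
    2ℚ = 1ℚ ℚ.+ 1ℚ

    l²/4 : ∀ l → + (l ℕ.^ 2) / 4 ≡ N l * N l * ¼
    l²/4 l = ≡.trans (/-N (+ (l ℕ.^ 2)) 4) (≡.cong (_* ¼) (N-^2 l))

    N-2* : ∀ l → N (2 ℕ.* l) ≡ 2ℚ * N l
    N-2* l = N-* 2 l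

    N-2*+1 : ∀ l → N (2 ℕ.* l ℕ.+ 1) ≡ 2ℚ * N l ℚ.+ 1ℚ
    N-2*+1 l = ≡.trans (N-+ (2 ℕ.* l) 1) (≡.cong (ℚ._+ 1ℚ) (N-2* l))

    γ½≡-g⁻ : ∀ l → γ½ l ≡ - g⁻ l
    γ½≡-g⁻ l = ≡.trans (solve 2 (λ u l →
        l :* l :* ((l :+ con ½ :- con ½) :* (l :+ con ½ :- con ½) :- (con ½ :* u) :* (con ½ :* u))
        := :- (l :* l :* con ¼ :* (u :* (u :* con 1ℚ) :- (con 2ℚ :* l) :* ((con 2ℚ :* l) :* con 1ℚ))))
      ≡.refl u (N l)) (≡.sym (≡.cong₂ (λ a b → - (a * (u ^ 2 - b ^ 2))) (l²/4 l) (N-2* l)))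

    γ⁰≡-g⁺ : ∀ l → γ⁰ l ≡ - g⁺ l
    γ⁰≡-g⁺ l = ≡.trans (solve 2 (λ u l → let a = con 2ℚ :* l :- con 1ℚ in
        l :* l :* ((l :+ con 0ℚ :- con ½) :* (l :+ con 0ℚ :- con ½) :- (con ½ :* u) :* (con ½ :* u))
        := :- (l :* l :* con ¼ :* (u :* (u :* con 1ℚ) :- a :* (a :* con 1ℚ))))
      ≡.refl u (N l)) (≡.sym (≡.cong₂ (λ a b → - (a * (u ^ 2 - (b - 1ℚ) ^ 2))) (l²/4 l) (N-2* l)))

    -- `γ¹ l` and -`g⁺ (suc l)` share the factor (l + 1/2)² - v and differ only by l² against (l +
    -- 1)².
    γ¹-g⁺ : ∀ l → γ¹ l * (N (suc l) * N (suc l)) ≡ - (N l * N l) * g⁺ (suc l)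
    γ¹-g⁺ l = begin
      γ¹ l * (N (suc l) * N (suc l))   ≡⟨ ≡.cong (λ m → γ¹ l * (m * m)) (N-suc l) ⟩
      γ¹ l * ((1ℚ ℚ.+ N l) * (1ℚ ℚ.+ N l))
        ≡⟨ solve 2 (λ u l → let m = con 1ℚ :+ l ; a = con 2ℚ :* m :- con 1ℚ in
             l :* l :* ((l :+ con 1ℚ :- con ½) :* (l :+ con 1ℚ :- con ½) :- (con ½ :* u) :* (con ½ :* u)) :* (m :* m)
             := :- (l :* l) :* (m :* m :* con ¼ :* (u :* (u :* con 1ℚ) :- a :* (a :* con 1ℚ))))
           ≡.refl u (N l) ⟩
      - (N l * N l) * ((1ℚ ℚ.+ N l) * (1ℚ ℚ.+ N l) * ¼ * (u ^ 2 - (2ℚ * (1ℚ ℚ.+ N l) - 1ℚ) ^ 2))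
        ≡⟨ ≡.cong₂ (λ a b → - (N l * N l) * (a * (u ^ 2 - (b - 1ℚ) ^ 2)))
             (≡.trans (l²/4 (suc l)) (≡.cong (λ m → m * m * ¼) (N-suc l)))
             (≡.trans (N-2* (suc l)) (≡.cong (2ℚ *_) (N-suc l))) ⟨
      - (N l * N l) * g⁺ (suc l)       ∎

    γ⁰γ¹≡dd : ∀ l → γ⁰ (suc l) * γ¹ (suc l) ≡
      (N (suc l) * N (suc l)) * (N (suc l) * N (suc l)) * (¼ * ¼) * (d l * d (suc l))
    γ⁰γ¹≡dd l = begin
      γ⁰ (suc l) * γ¹ (suc l)
        ≡⟨ solve 2 (λ u m → let a = con 2ℚ :* m :- con 1ℚ ; b = con 2ℚ :* m :+ con 1ℚ in
             m :* m :* ((m :+ con 0ℚ :- con ½) :* (m :+ con 0ℚ :- con ½) :- (con ½ :* u) :* (con ½ :* u))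
             :* (m :* m :* ((m :+ con 1ℚ :- con ½) :* (m :+ con 1ℚ :- con ½) :- (con ½ :* u) :* (con ½ :* u)))
             := (m :* m) :* (m :* m) :* (con ¼ :* con ¼)
                :* ((u :* (u :* con 1ℚ) :- a :* (a :* con 1ℚ)) :* (u :* (u :* con 1ℚ) :- b :* (b :* con 1ℚ))))
           ≡.refl u (N (suc l)) ⟩
      M * ((u ^ 2 - (2ℚ * N (suc l) - 1ℚ) ^ 2) * (u ^ 2 - (2ℚ * N (suc l) ℚ.+ 1ℚ) ^ 2))
        ≡⟨ ≡.cong₂ (λ a b → M * ((u ^ 2 - a ^ 2) * (u ^ 2 - b ^ 2))) (≡.sym 2l+1) (≡.sym (N-2*+1 (suc l))) ⟩
      M * (d l * d (suc l)) ∎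
      where
      M = (N (suc l) * N (suc l)) * (N (suc l) * N (suc l)) * (¼ * ¼)
      2l+1 : N (2 ℕ.* l ℕ.+ 1) ≡ 2ℚ * N (suc l) - 1ℚ
      2l+1 = ≡.trans (N-2*+1 l) (≡.trans
        (solve 1 (λ l → con 2ℚ :* l :+ con 1ℚ := con 2ℚ :* (con 1ℚ :+ l) :- con 1ℚ) ≡.refl (N l))
        (≡.cong (λ m → 2ℚ * m - 1ℚ) (≡.sym (N-suc l))))

    σ : ℕ → ℚ
    σ k = (- 1ℚ) ^ k

    σσ≡1 : ∀ k → σ k * σ k ≡ 1ℚ
    σσ≡1 zero    = ≡.refl
    σσ≡1 (suc k) = ≡.trans (solve 1 (λ s → (:- con 1ℚ :* s) :* (:- con 1ℚ :* s) := s :* s) ≡.refl (σ k)) (σσ≡1 k)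

    ∏<-neg : ∀ (f : ℕ → ℚ) n → ∏< (λ i → - f i) n ≡ σ n * ∏< f n
    ∏<-neg f zero    = ≡.refl
    ∏<-neg f (suc n) = ≡.trans (≡.cong (_* (- f n)) (∏<-neg f n))
      (solve 3 (λ s p f → s :* p :* :- f := (:- con 1ℚ :* s) :* (p :* f)) ≡.refl (σ n) (∏< f n) (f n))

    ∏<-square-* : ∀ (f g : ℕ → ℚ) n → ∏< (λ i → f i * (f i * g i)) n ≡ ∏< f n * ∏< f n * ∏< g n
    ∏<-square-* f g zero    = ≡.refl
    ∏<-square-* f g (suc n) = ≡.trans (≡.cong (_* (f n * (f n * g n))) (∏<-square-* f g n))
      (solve 4 (λ p q f g → p :* p :* q :* (f :* (f :* g)) := p :* f :* (p :* f) :* (q :* g)) ≡.refl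
        (∏< f n) (∏< g n) (f n) (g n))

    P : (ℕ → ℚ) → ℕ → ℚ
    P g = ∏< (g ∘ suc)

    P² : (ℕ → ℚ) → ℕ → ℚ
    P² g n = ∏< (λ k → P g k * P g k) n

    -- Interchange of a double product: `g l` occurs in `P g k` exactly for l ≤ k ≤ m, hence m + 1 -
    -- l times, each time squared.
    triangle-even : ∀ g m → ∏[ l from 1 to m ] g l ^ (2 ℕ.* (m ℕ.+ 1 ∸ l)) ≡ P² g (suc m)
    triangle-even g m = ≡.trans (∏≡∏< 1 m (λ l → g l ^ (2 ℕ.* (m ℕ.+ 1 ∸ l)))) (triangle m)
      where
      factor : ℕ → ℕ → ℚ
      factor m i = g (suc i) ^ (2 ℕ.* (m ℕ.+ 1 ∸ suc i))
      factor-suc : ∀ m i → i < m → factor (suc m) i ≡ g (suc i) * (g (suc i) * factor m i)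
      factor-suc m i i<m = ≡.cong (g (suc i) ^_) (≡.trans
        (≡.cong (2 ℕ.*_) (ℕ.+-∸-assoc 1 (ℕ.≤-trans i<m (ℕ.m≤m+n m 1))))
        (ℕ.*-suc 2 (m ℕ.+ 1 ∸ suc i)))
      factor-last : ∀ m → factor (suc m) m ≡ g (suc m) * (g (suc m) * 1ℚ)
      factor-last m = ≡.cong (λ e → g (suc m) ^ (2 ℕ.* e)) (ℕ.m+n∸m≡n m 1)
      triangle : ∀ m → ∏< (factor m) m ≡ P² g (suc m)
      triangle zero    = ≡.refl
      triangle (suc m) = begin
        ∏< (factor (suc m)) m * factor (suc m) m
          ≡⟨ ≡.cong₂ _*_ (∏<-cong-< m (factor-suc m)) (factor-last m) ⟩
        ∏< (λ i → g (suc i) * (g (suc i) * factor m i)) m * (g (suc m) * (g (suc m) * 1ℚ))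
          ≡⟨ ≡.cong (_* (g (suc m) * (g (suc m) * 1ℚ))) (∏<-square-* (g ∘ suc) (factor m) m) ⟩
        P g m * P g m * ∏< (factor m) m * (g (suc m) * (g (suc m) * 1ℚ))
          ≡⟨ ≡.cong (λ t → P g m * P g m * t * (g (suc m) * (g (suc m) * 1ℚ))) (triangle m) ⟩
        P g m * P g m * P² g (suc m) * (g (suc m) * (g (suc m) * 1ℚ))
          ≡⟨ solve 3 (λ p t g → p :* p :* t :* (g :* (g :* con 1ℚ)) := t :* (p :* g :* (p :* g))) ≡.refl
               (P g m) (P² g (suc m)) (g (suc m)) ⟩
        P² g (suc m) * (P g (suc m) * P g (suc m)) ∎

    -- `d l` occurs once at k = l and twice for each k with l < k ≤ m, which gives the exponent.
    triangle-odd : ∀ (c d : ℕ → ℚ) m → ∏[ l from 0 to m ] (c l * d l ^ (2 ℕ.* (m ∸ l) ℕ.+ 1))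
      ≡ ∏< (λ k → c k * d k * (∏< d k * ∏< d k)) (suc m)
    triangle-odd c d m = ≡.trans (∏≡∏< 0 m (λ l → c l * d l ^ (2 ℕ.* (m ∸ l) ℕ.+ 1))) (triangle m)
      where
      factor : ℕ → ℕ → ℚ
      factor m i = c i * d i ^ (2 ℕ.* (m ∸ i) ℕ.+ 1)
      factor-suc : ∀ m i → i < suc m → factor (suc m) i ≡ d i * (d i * factor m i)
      factor-suc m i (s≤s i≤m) = ≡.trans
        (≡.cong (λ e → c i * d i ^ (e ℕ.+ 1)) (≡.trans (≡.cong (2 ℕ.*_) (ℕ.+-∸-assoc 1 i≤m)) (ℕ.*-suc 2 (m ∸ i))))
        (solve 3 (λ c d e → c :* (d :* (d :* e)) := d :* (d :* (c :* e))) ≡.refl (c i) (d i) (d i ^ (2 ℕ.* (m ∸ i) ℕ.+ 1)))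
      factor-last : ∀ m → factor m m ≡ c m * d m
      factor-last m = ≡.trans (≡.cong (λ e → c m * d m ^ (2 ℕ.* e ℕ.+ 1)) (ℕ.n∸n≡0 m))
        (≡.cong (c m *_) (ℚ.*-identityʳ (d m)))
      triangle : ∀ m → ∏< (factor m) (suc m) ≡ ∏< (λ k → c k * d k * (∏< d k * ∏< d k)) (suc m)
      triangle zero = solve 2 (λ c d → con 1ℚ :* (c :* (d :* con 1ℚ)) := con 1ℚ :* (c :* d :* con 1ℚ)) ≡.refl (c 0) (d 0)
      triangle (suc m) = begin
        ∏< (factor (suc m)) (suc m) * factor (suc m) (suc m)
          ≡⟨ ≡.cong₂ _*_ (∏<-cong-< (suc m) (factor-suc m)) (factor-last (suc m)) ⟩
        ∏< (λ i → d i * (d i * factor m i)) (suc m) * (c (suc m) * d (suc m))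
          ≡⟨ ≡.cong (_* (c (suc m) * d (suc m))) (∏<-square-* d (factor m) (suc m)) ⟩
        D * D * ∏< (factor m) (suc m) * (c (suc m) * d (suc m))
          ≡⟨ ≡.cong (λ t → D * D * t * (c (suc m) * d (suc m))) (triangle m) ⟩
        D * D * t * (c (suc m) * d (suc m))
          ≡⟨ solve 4 (λ p t c d → p :* p :* t :* (c :* d) := t :* (c :* d :* (p :* p))) ≡.refl
               D t (c (suc m)) (d (suc m)) ⟩
        t * (c (suc m) * d (suc m) * (D * D)) ∎
        where
        D = ∏< d (suc m)
        t = ∏< (λ k → c k * d k * (∏< d k * ∏< d k)) (suc m)

  -- Each of the m + 1 blocks contributes minus the square of its norm; squaring removes the sign of
  -- the norm and leaves one -1 and one u² per block.
  difference-product : ∀ m → ∏< (λ k → - (norms v ½ (- u) k * norms v ½ (- u) k)) (suc m) ≡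
    (- 1ℚ) ^ (m ℕ.+ 1) * u ^ (2 ℕ.* m ℕ.+ 2) * (∏[ l from 1 to m ] g⁻ l ^ (2 ℕ.* (m ℕ.+ 1 ∸ l)))
  difference-product m = begin
    ∏< (λ k → - (h k * h k)) (suc m)                    ≡⟨ closed (suc m) ⟩
    σ (suc m) * u ^ (suc m ℕ.* 2) * P² g⁻ (suc m)
      ≡⟨ ≡.cong₂ (λ a b → σ a * u ^ b * P² g⁻ (suc m)) (ℕ.+-comm 1 m)
           (≡.trans (ℕ.+-comm 2 (m ℕ.* 2)) (≡.cong (ℕ._+ 2) (ℕ.*-comm m 2))) ⟩
    σ (m ℕ.+ 1) * u ^ (2 ℕ.* m ℕ.+ 2) * P² g⁻ (suc m)
      ≡⟨ ≡.cong (σ (m ℕ.+ 1) * u ^ (2 ℕ.* m ℕ.+ 2) *_) (triangle-even g⁻ m) ⟨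
    _ ∎
    where
    h = norms v ½ (- u)
    h≡ : ∀ k → h k ≡ - u * (σ k * P g⁻ k)
    h≡ k = ≡.cong (- u *_) (≡.trans (∏<-cong (λ i → γ½≡-g⁻ (suc i)) k) (∏<-neg (g⁻ ∘ suc) k))
    closed : ∀ n → ∏< (λ k → - (h k * h k)) n ≡ σ n * u ^ (n ℕ.* 2) * P² g⁻ n
    closed zero    = ≡.refl
    closed (suc n) = begin
      ∏< (λ k → - (h k * h k)) n * - (h n * h n)
        ≡⟨ ≡.cong₂ (λ a b → a * - (b * b)) (closed n) (h≡ n) ⟩
      σ n * u ^ (n ℕ.* 2) * P² g⁻ n * - (- u * (σ n * P g⁻ n) * (- u * (σ n * P g⁻ n)))
        ≡⟨ solve 5 (λ s U Q u p → s :* U :* Q :* :- (:- u :* (s :* p) :* (:- u :* (s :* p)))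
             := (s :* s) :* ((:- con 1ℚ :* s) :* (u :* (u :* U)) :* (Q :* (p :* p)))) ≡.refl
             (σ n) (u ^ (n ℕ.* 2)) (P² g⁻ n) u (P g⁻ n) ⟩
      σ n * σ n * r   ≡⟨ ≡.trans (≡.cong (_* r) (σσ≡1 n)) (ℚ.*-identityˡ r) ⟩
      r               ∎
      where r = σ (suc n) * u ^ (suc n ℕ.* 2) * P² g⁻ (suc n)

  h⁰ h¹ hh : ℕ → ℚ
  h⁰ = norms v 0ℚ (1ℚ ℚ.+ 1ℚ)
  h¹ = norms v 1ℚ ((1ℚ ℚ.+ 1ℚ) * (v - ½ * ½))
  hh = parity (λ _ → ℚ) h⁰ h¹

  private
    hh-even : ∀ k → hh (k ℕ.* 2) ≡ h⁰ k
    hh-even = parity-even (λ _ → ℚ) h⁰ h¹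

    hh-odd : ∀ k → hh (suc (k ℕ.* 2)) ≡ h¹ k
    hh-odd = parity-odd (λ _ → ℚ) h⁰ h¹

    h⁰≡ : ∀ k → h⁰ k ≡ 2ℚ * (σ k * P g⁺ k)
    h⁰≡ k = ≡.cong (2ℚ *_) (≡.trans (∏<-cong (λ i → γ⁰≡-g⁺ (suc i)) k) (∏<-neg (g⁺ ∘ suc) k))

    -- Telescoping: by `γ¹-g⁺` the ratios l² / (l + 1)² for l = 1, ..., k multiply to 1 / (k + 1)².
    -- The initial value 2 (v - 1/4) is twice `g⁺ 1`.
    h¹≡ : ∀ k → h¹ k * (N (suc k) * N (suc k)) ≡ 2ℚ * (σ k * P g⁺ (suc k))
    h¹≡ zero = solve 1 (λ u → (con 2ℚ :* ((con ½ :* u) :* (con ½ :* u) :- con ½ :* con ½)) :* con 1ℚ :* (con 1ℚ :* con 1ℚ)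
      := con 2ℚ :* (con 1ℚ :* (con 1ℚ :* (con ¼ :* (u :* (u :* con 1ℚ) :- con 1ℚ :* (con 1ℚ :* con 1ℚ)))))) ≡.refl u
    h¹≡ (suc k) = begin
      2ℚ * (v - ½ * ½) * (∏< (γ¹ ∘ suc) k * γ¹ (suc k)) * n²
        ≡⟨ solve 4 (λ a p g n → a :* (p :* g) :* n := a :* p :* (g :* n)) ≡.refl
             (2ℚ * (v - ½ * ½)) (∏< (γ¹ ∘ suc) k) (γ¹ (suc k)) n² ⟩
      h¹ k * (γ¹ (suc k) * n²)                             ≡⟨ ≡.cong (h¹ k *_) (γ¹-g⁺ (suc k)) ⟩
      h¹ k * (- (N (suc k) * N (suc k)) * g⁺ (suc (suc k)))
        ≡⟨ solve 3 (λ h n g → h :* (:- n :* g) := :- (h :* n) :* g) ≡.refl (h¹ k) (N (suc k) * N (suc k)) (g⁺ (suc (suc k))) ⟩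
      - (h¹ k * (N (suc k) * N (suc k))) * g⁺ (suc (suc k))
        ≡⟨ ≡.cong (λ a → - a * g⁺ (suc (suc k))) (h¹≡ k) ⟩
      - (2ℚ * (σ k * P g⁺ (suc k))) * g⁺ (suc (suc k))
        ≡⟨ solve 3 (λ s p g → :- (con 2ℚ :* (s :* p)) :* g := con 2ℚ :* ((:- con 1ℚ :* s) :* (p :* g))) ≡.refl
             (σ k) (P g⁺ (suc k)) (g⁺ (suc (suc k))) ⟩
      2ℚ * (σ (suc k) * P g⁺ (suc (suc k)))               ∎
      where n² = N (suc (suc k)) * N (suc (suc k))

    ρ : ℕ → ℚ
    ρ k = + 1 / suc k

    h¹≡′ : ∀ k → h¹ k ≡ 2ℚ * (σ k * P g⁺ (suc k)) * (ρ k * ρ k)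
    h¹≡′ k = begin
      h¹ k                                         ≡⟨ ℚ.*-identityʳ (h¹ k) ⟨
      h¹ k * (1ℚ * 1ℚ)                             ≡⟨ ≡.cong (λ a → h¹ k * (a * a)) (/-*-N (+ 1) (suc k)) ⟨
      h¹ k * (ρ k * N (suc k) * (ρ k * N (suc k)))
        ≡⟨ solve 3 (λ h r n → h :* (r :* n :* (r :* n)) := h :* (n :* n) :* (r :* r)) ≡.refl (h¹ k) (ρ k) (N (suc k)) ⟩
      h¹ k * (N (suc k) * N (suc k)) * (ρ k * ρ k) ≡⟨ ≡.cong (_* (ρ k * ρ k)) (h¹≡ k) ⟩
      2ℚ * (σ k * P g⁺ (suc k)) * (ρ k * ρ k)      ∎

  F : ℕ → ℚ
  F m = (+ (2 ℕ.^ (2 ℕ.* m ℕ.+ 1)) / ((m !) ℕ.^ 2)) {{ℕ.m^n≢0 (m !) 2 {{m ℕ.!≢0}}}}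

  c : ℕ → ℚ
  c l = (+ ((l !) ℕ.^ 4) / (16 ℕ.^ l)) {{ℕ.m^n≢0 16 l}}

  private
    F-suc : ∀ m → F (suc m) ≡ F m * (2ℚ * 2ℚ) * (ρ m * ρ m)
    F-suc m = N-cancel ((suc m !) ℕ.^ 2) {{suc≢0}} (begin
      F (suc m) * N ((suc m !) ℕ.^ 2)                ≡⟨ /-*-N (+ (2 ℕ.^ (2 ℕ.* suc m ℕ.+ 1))) ((suc m !) ℕ.^ 2) {{suc≢0}} ⟩
      N (2 ℕ.^ (2 ℕ.* suc m ℕ.+ 1))                  ≡⟨ ≡.cong (λ e → N (2 ℕ.^ (e ℕ.+ 1))) (ℕ.*-suc 2 m) ⟩
      N (2 ℕ.* (2 ℕ.* 2 ℕ.^ (2 ℕ.* m ℕ.+ 1)))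
        ≡⟨ ≡.trans (N-* 2 (2 ℕ.* 2 ℕ.^ (2 ℕ.* m ℕ.+ 1))) (≡.cong (2ℚ *_) (N-* 2 (2 ℕ.^ (2 ℕ.* m ℕ.+ 1)))) ⟩
      2ℚ * (2ℚ * N (2 ℕ.^ (2 ℕ.* m ℕ.+ 1)))          ≡⟨ ≡.cong (λ a → 2ℚ * (2ℚ * a)) (/-*-N (+ (2 ℕ.^ (2 ℕ.* m ℕ.+ 1))) ((m !) ℕ.^ 2) {{m≢0}}) ⟨
      2ℚ * (2ℚ * (F m * N ((m !) ℕ.^ 2)))            ≡⟨ ℚ.*-identityʳ _ ⟨
      2ℚ * (2ℚ * (F m * N ((m !) ℕ.^ 2))) * (1ℚ * 1ℚ)
        ≡⟨ ≡.cong₂ (λ a b → 2ℚ * (2ℚ * (F m * a)) * (b * b)) (≡.sym (N-^2 (m !)) ) (/-*-N (+ 1) (suc m)) ⟨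
      2ℚ * (2ℚ * (F m * (N (m !) * N (m !)))) * (ρ m * N (suc m) * (ρ m * N (suc m)))
        ≡⟨ solve 4 (λ f a r n → con 2ℚ :* (con 2ℚ :* (f :* (a :* a))) :* (r :* n :* (r :* n))
             := f :* (con 2ℚ :* con 2ℚ) :* (r :* r) :* (n :* a :* (n :* a))) ≡.refl (F m) (N (m !)) (ρ m) (N (suc m)) ⟩
      F m * (2ℚ * 2ℚ) * (ρ m * ρ m) * (N (suc m) * N (m !) * (N (suc m) * N (m !)))
        ≡⟨ ≡.cong (F m * (2ℚ * 2ℚ) * (ρ m * ρ m) *_)
             (≡.trans (N-^2 (suc m !)) (≡.cong (λ a → a * a) (N-* (suc m) (m !)))) ⟨
      F m * (2ℚ * 2ℚ) * (ρ m * ρ m) * N ((suc m !) ℕ.^ 2) ∎)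
      where
      suc≢0 = ℕ.m^n≢0 (suc m !) 2 {{suc m ℕ.!≢0}}
      m≢0 = ℕ.m^n≢0 (m !) 2 {{m ℕ.!≢0}}

    c-suc : ∀ l → c (suc l) ≡ c l * ((N (suc l) * N (suc l)) * (N (suc l) * N (suc l)) * (¼ * ¼))
    c-suc l = N-cancel (16 ℕ.^ suc l) {{ℕ.m^n≢0 16 (suc l)}} (begin
      c (suc l) * N (16 ℕ.^ suc l)           ≡⟨ /-*-N (+ ((suc l !) ℕ.^ 4)) (16 ℕ.^ suc l) {{ℕ.m^n≢0 16 (suc l)}} ⟩
      N ((suc l ℕ.* l !) ℕ.^ 4)              ≡⟨ N-^4 (suc l ℕ.* l !) ⟩
      fourth (N (suc l ℕ.* l !))             ≡⟨ ≡.cong fourth (N-* (suc l) (l !)) ⟩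
      fourth (N (suc l) * N (l !))
        ≡⟨ solve 2 (λ n a → n :* a :* (n :* a :* (n :* a :* (n :* a)))
             := a :* (a :* (a :* a)) :* ((n :* n) :* (n :* n) :* (con ¼ :* con ¼)) :* con (N 16)) ≡.refl (N (suc l)) (N (l !)) ⟩
      fourth (N (l !)) * n⁴ * N 16
        ≡⟨ ≡.cong (λ a → a * n⁴ * N 16) (≡.trans (/-*-N (+ ((l !) ℕ.^ 4)) (16 ℕ.^ l) {{ℕ.m^n≢0 16 l}}) (N-^4 (l !))) ⟨
      c l * N (16 ℕ.^ l) * n⁴ * N 16
        ≡⟨ solve 4 (λ c e n s → c :* e :* n :* s := c :* n :* (s :* e)) ≡.refl (c l) (N (16 ℕ.^ l)) n⁴ (N 16) ⟩
      c l * n⁴ * (N 16 * N (16 ℕ.^ l))       ≡⟨ ≡.cong (c l * n⁴ *_) (N-* 16 (16 ℕ.^ l)) ⟨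
      c l * n⁴ * N (16 ℕ.^ suc l)            ∎)
      where
      n⁴ = (N (suc l) * N (suc l)) * (N (suc l) * N (suc l)) * (¼ * ¼)
      fourth : ℚ → ℚ
      fourth a = a * (a * (a * a))
      N-^4 : ∀ a → N (a ℕ.^ 4) ≡ fourth (N a)
      N-^4 a = ≡.trans (N-* a (a ℕ.^ 3)) (≡.cong (N a *_)
        (≡.trans (N-* a (a ℕ.^ 2)) (≡.cong (N a *_) (N-^2 a))))

  -- From m to m + 1 the norms `h¹ m` and `h⁰ (suc m)` are added. They carry the same product of
  -- `g⁺` with opposite signs, and their constants give 4 / (m + 1)², the ratio in `F-suc`.
  sum-product-even : ∀ m → ∏< hh (suc (m ℕ.* 2)) ≡
    (- 1ℚ) ^ m * F m * (∏[ l from 1 to m ] g⁺ l ^ (2 ℕ.* (m ℕ.+ 1 ∸ l)))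
  sum-product-even m = ≡.trans (closed m) (≡.cong (σ m * F m *_) (≡.sym (triangle-even g⁺ m)))
    where
    closed : ∀ m → ∏< hh (suc (m ℕ.* 2)) ≡ σ m * F m * P² g⁺ (suc m)
    closed zero    = ≡.refl
    closed (suc m) = begin
      ∏< hh (suc (m ℕ.* 2)) * hh (suc (m ℕ.* 2)) * hh (suc m ℕ.* 2)
        ≡⟨ ≡.cong₂ _*_ (≡.cong₂ _*_ (closed m) (≡.trans (hh-odd m) (h¹≡′ m)))
                       (≡.trans (hh-even (suc m)) (h⁰≡ (suc m))) ⟩
      σ m * F m * Q * (2ℚ * (σ m * p) * (ρ m * ρ m)) * (2ℚ * (σ (suc m) * p))
        ≡⟨ solve 6 (λ s f q p r t → s :* f :* q :* (con 2ℚ :* (s :* p) :* (r :* r)) :* (con 2ℚ :* (t :* p))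
             := s :* s :* (t :* (f :* (con 2ℚ :* con 2ℚ) :* (r :* r)) :* (q :* (p :* p)))) ≡.refl
             (σ m) (F m) Q p (ρ m) (σ (suc m)) ⟩
      σ m * σ m * (σ (suc m) * (F m * (2ℚ * 2ℚ) * (ρ m * ρ m)) * (Q * (p * p)))
        ≡⟨ ≡.cong₂ (λ a b → a * (σ (suc m) * b * (Q * (p * p)))) (σσ≡1 m) (≡.sym (F-suc m)) ⟩
      1ℚ * (σ (suc m) * F (suc m) * (Q * (p * p)))   ≡⟨ ℚ.*-identityˡ _ ⟩
      σ (suc m) * F (suc m) * (Q * (p * p))          ∎
      where
      Q = P² g⁺ (suc m)
      p = P g⁺ (suc m)

  -- Here `h⁰ k` is paired with `h¹ k`. Each step from one pair to the next multiplies by (k + 1)⁴ /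
  -- 16 and two neighbouring values of `d`, so the pair contains `d k` once and every earlier `d`
  -- twice.
  sum-product-odd : ∀ m → ∏< hh (suc (suc (m ℕ.* 2))) ≡
    ∏[ l from 0 to m ] (c l * d l ^ (2 ℕ.* (m ∸ l) ℕ.+ 1))
  sum-product-odd m = ≡.trans (closed (suc m)) (≡.sym (triangle-odd c d m))
    where
    pair : ∀ k → h⁰ k * h¹ k ≡ c k * d k * (∏< d k * ∏< d k)
    pair zero = solve 1 (λ u → (con 2ℚ :* con 1ℚ) :* (con 2ℚ :* ((con ½ :* u) :* (con ½ :* u) :- con ½ :* con ½) :* con 1ℚ)
      := con 1ℚ :* (u :* (u :* con 1ℚ) :- con 1ℚ :* (con 1ℚ :* con 1ℚ)) :* con 1ℚ) ≡.refl u
    pair (suc k) = begin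
      2ℚ * (a * γ⁰ (suc k)) * (e * (b * γ¹ (suc k)))
        ≡⟨ solve 6 (λ t a g e b h → t :* (a :* g) :* (e :* (b :* h)) := t :* a :* (e :* b) :* (g :* h)) ≡.refl
             2ℚ a (γ⁰ (suc k)) e b (γ¹ (suc k)) ⟩
      h⁰ k * h¹ k * (γ⁰ (suc k) * γ¹ (suc k))        ≡⟨ ≡.cong₂ _*_ (pair k) (γ⁰γ¹≡dd k) ⟩
      c k * d k * (D * D) * (n⁴ * (d k * d (suc k)))
        ≡⟨ solve 5 (λ c d D n d′ → c :* d :* (D :* D) :* (n :* (d :* d′)) := c :* n :* d′ :* (D :* d :* (D :* d))) ≡.refl
             (c k) (d k) D n⁴ (d (suc k)) ⟩
      c k * n⁴ * d (suc k) * (D * d k * (D * d k))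
        ≡⟨ ≡.cong (λ x → x * d (suc k) * (D * d k * (D * d k))) (c-suc k) ⟨
      c (suc k) * d (suc k) * (D * d k * (D * d k))  ∎
      where
      a = ∏< (γ⁰ ∘ suc) k
      b = ∏< (γ¹ ∘ suc) k
      e = 2ℚ * (v - ½ * ½)
      D = ∏< d k
      n⁴ = (N (suc k) * N (suc k)) * (N (suc k) * N (suc k)) * (¼ * ¼)
    closed : ∀ n → ∏< hh (n ℕ.* 2) ≡ ∏< (λ k → c k * d k * (∏< d k * ∏< d k)) n
    closed zero    = ≡.refl
    closed (suc n) = begin
      ∏< hh (n ℕ.* 2) * hh (n ℕ.* 2) * hh (suc (n ℕ.* 2))
        ≡⟨ ≡.cong₂ (λ a b → ∏< hh (n ℕ.* 2) * a * b) (hh-even n) (hh-odd n) ⟩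
      ∏< hh (n ℕ.* 2) * h⁰ n * h¹ n                  ≡⟨ ℚ.*-assoc (∏< hh (n ℕ.* 2)) (h⁰ n) (h¹ n) ⟩
      ∏< hh (n ℕ.* 2) * (h⁰ n * h¹ n)                ≡⟨ ≡.cong₂ _*_ (closed n) (pair n) ⟩
      _                                              ∎

theorem4p3 : ∀ {c ℓ} (A : ℚAlgebra c ℓ) →
  let open Euler A in
  (q : ℕ) .{{_ : NonZero q}} (r s : ℕ) → r < s → (x : Carrier) →
  let u : ℚ
      u = (+ s ℤ.- + r) / q in
  (m : ℕ) →
  (H (2 ℕ.* m) (e⁻ q r s x) ≈ 0#)
  ×
  (H (2 ℕ.* m ℕ.+ 1) (e⁻ q r s x) ≈
    ι ((- 1ℚ) ^ (m ℕ.+ 1) * u ^ (2 ℕ.* m ℕ.+ 2)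
       * (∏[ l from 1 to m ]
            ((+ (l ℕ.^ 2) / 4) * (u ^ 2 - (+ (2 ℕ.* l) / 1) ^ 2))
              ^ (2 ℕ.* (m ℕ.+ 1 ℕ.∸ l)))))
  ×
  (H (2 ℕ.* m) (e⁺ q r s x) ≈
    ι ((- 1ℚ) ^ m
       * (+ (2 ℕ.^ (2 ℕ.* m ℕ.+ 1)) / ((m !) ℕ.^ 2)) {{m^n≢0 (m !) 2 {{m !≢0}}}}
       * (∏[ l from 1 to m ]
            ((+ (l ℕ.^ 2) / 4) * (u ^ 2 - (+ (2 ℕ.* l) / 1 - 1ℚ) ^ 2))
              ^ (2 ℕ.* (m ℕ.+ 1 ℕ.∸ l)))))
  ×
  (H (2 ℕ.* m ℕ.+ 1) (e⁺ q r s x) ≈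
    ι (∏[ l from 0 to m ]
         ((+ ((l !) ℕ.^ 4) / (16 ℕ.^ l)) {{m^n≢0 16 l}}
          * (u ^ 2 - (+ (2 ℕ.* l ℕ.+ 1) / 1) ^ 2) ^ (2 ℕ.* (m ℕ.∸ l) ℕ.+ 1))))
theorem4p3 A q r s _ x m =
    at e⁻′ 2m≡ (proj₁ (difference m))
  , at e⁻′ 2m+1≡ (trans (proj₂ (difference m)) (ι-cong (difference-product m)))
  , at e⁺′ 2m≡ (trans (sum (m ℕ.* 2)) (ι-cong (sum-product-even m)))
  , at e⁺′ 2m+1≡ (trans (sum (suc (m ℕ.* 2))) (ι-cong (sum-product-odd m)))
  where
  open Euler A
  open ℚAlgebra A using (trans; reflexive)
  open EulerHankel A
  open ProductFormulas ((+ s ℤ.- + r) / q)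
  e⁻′ = e⁻ q r s x
  e⁺′ = e⁺ q r s x
  difference = Euler-difference-hankel (arg-difference q r s x)
  sum = Euler-sum-hankel (arg-difference q r s x)
  ι-cong : ∀ {a b} → a ≡ b → ι a ≈ ι b
  ι-cong a≡b = reflexive (≡.cong ι a≡b)
  at : ∀ (e : ℕ → Carrier) {n n′ a} → n ≡ n′ → H n′ e ≈ a → H n e ≈ a
  at e n≡n′ = trans (reflexive (≡.cong (λ n → H n e) n≡n′))
  2m≡ : 2 ℕ.* m ≡ m ℕ.* 2
  2m≡ = ℕ.*-comm 2 m
  2m+1≡ : 2 ℕ.* m ℕ.+ 1 ≡ suc (m ℕ.* 2)
  2m+1≡ = ≡.trans (ℕ.+-comm (2 ℕ.* m) 1) (≡.cong suc 2m≡)
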